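{- Let $t\ge 2$, $r<k\le 2r$ and $n\ge 8t^2$ be integers (with $r\ge 1$). Then \[ \mathrm{ex}_k(n, K_{r+1}(t))\ \ge\ t_r(k)n^2 + z_t(n, n) + (t-1)(k-r-1)n + \min\{k-r-1,\, 2r-k\}\left\lfloor \frac{(t-1)^2}{4} \right\rfloor. \]
   Context: $K_{r+1}(t)$ denotes the complete $(r+1)$-partite graph with exactly $t$ vertices in each part. For integers $k,n$, $\mathcal G_k(n)$ is the family of $k$-partite graphs with $k$ given vertex classes $V_1,\dots,V_k$, each of size $n$ (edges only join vertices in different classes). For a graph $F$, $\mathrm{ex}_k(n,F)$ is the maximum number of edges of a graph in $\mathcal G_k(n)$ containing no copy of $F$ as a subgraph. $t_r(k)$ is the number of edges of the Turán graph $T_r(k)$, the complete $r$-partite graph on $k$ vertices with part sizes $\lfloor k/r\rfloor$ or $\lceil k/r\rceil$. $z_t(m,n)$ (Zarankiewicz number) is the maximum number of edges in a bipartite graph with parts of sizes $m$ and $n$ containing no copy of $K_{t,t}$. -}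

module Defs where

open import Data.Nat using (ℕ; zero; suc; _+_; _*_; _<_; _≤_; NonZero)
open import Data.Nat.DivMod using (_%_)
open import Data.Fin using (Fin; toℕ)
import Data.Fin as F
open import Data.Bool using (Bool; true; false; if_then_else_)
open import Data.Product using (_×_; _,_; Σ; ∃)
open import Relation.Binary.PropositionalEquality using (_≡_; _≢_)
open import Relation.Nullary using (¬_; yes; no)
open import Data.Nat using (_≟_; _<?_)
open import Function.Definitions using (Injective)

sumFin : (n : ℕ) → (Fin n → ℕ) → ℕ
sumFin zero    f = 0
sumFin (suc n) f = f F.zero + sumFin n (λ i → f (F.suc i))

⟦_⟧ : Bool → ℕ
⟦ true ⟧  = 1
⟦ false ⟧ = 0

-- Graphs in 𝒢_k(n): vertex set V_1 ∪ … ∪ V_k with V_i = {i} × Fin n,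
-- simple undirected graph given by a symmetric Boolean adjacency,
-- edges only between different classes.

record KPartiteGraph (k n : ℕ) : Set where
  field
    adj       : Fin k → Fin n → Fin k → Fin n → Bool
    symmetric : ∀ i x j y → adj i x j y ≡ adj j y i x
    partite   : ∀ i x j y → adj i x j y ≡ true → i ≢ j
open KPartiteGraph public

-- number of edges: every edge joins two distinct classes i ≠ j, so it is
-- counted exactly once among the pairs with i < j.
edges : ∀ {k n} → KPartiteGraph k n → ℕ
edges {k} {n} G =
  sumFin k λ i → sumFin k λ j →
    if toℕ i <ᵇ' toℕ j
    then sumFin n (λ x → sumFin n (λ y → ⟦ adj G i x j y ⟧))
    else 0
  where
  _<ᵇ'_ : ℕ → ℕ → Bool
  a <ᵇ' b with a <? b
  ... | yes _ = true
  ... | no  _ = false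

ContainsCompleteMultipartite : ∀ {k n} → KPartiteGraph k n → (s t : ℕ) → Set
ContainsCompleteMultipartite {k} {n} G s t =
  Σ (Fin s × Fin t → Fin k × Fin n) λ φ →
    Injective _≡_ _≡_ φ ×
    (∀ a p b q → a ≢ b →
      let (i , x) = φ (a , p) ; (j , y) = φ (b , q) in adj G i x j y ≡ true)

BipartiteGraph : ℕ → ℕ → Set
BipartiteGraph m n = Fin m → Fin n → Bool

bipEdges : ∀ {m n} → BipartiteGraph m n → ℕ
bipEdges {m} {n} B = sumFin m λ x → sumFin n λ y → ⟦ B x y ⟧

ContainsKtt : ∀ {m n} → BipartiteGraph m n → ℕ → Set
ContainsKtt {m} {n} B t =
  Σ (Fin t → Fin m) λ f → Σ (Fin t → Fin n) λ g →
    Injective _≡_ _≡_ f × Injective _≡_ _≡_ g × (∀ a b → B (f a) (g b) ≡ true)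

-- Turán number t_r(k): edges of the Turán graph T_r(k), realised on Fin k
-- with vertex i in part (i mod r); parts then have sizes ⌊k/r⌋ or ⌈k/r⌉.

turanNumber : (r k : ℕ) → .{{NonZero r}} → ℕ
turanNumber r k = sumFin k λ i → sumFin k λ j → ind (toℕ i) (toℕ j)
  where
  ind : ℕ → ℕ → ℕ
  ind a b with a <? b | (a % r) ≟ (b % r)
  ... | yes _ | no _ = 1
  ... | _     | _    = 0

IsZarankiewicz : (t m n z : ℕ) → Set
IsZarankiewicz t m n z =
  (Σ (BipartiteGraph m n) λ B → ¬ ContainsKtt B t × bipEdges B ≡ z) ×
  (∀ (B : BipartiteGraph m n) → ¬ ContainsKtt B t → bipEdges B ≤ z)

-- ex_k(n, K_s(t)) ≥ N: since ex_k is a maximum over a finite nonempty family,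
-- this holds iff some K_s(t)-free G ∈ 𝒢_k(n) has at least N edges.
ExAtLeast : (k n s t N : ℕ) → Set
ExAtLeast k n s t N =
  Σ (KPartiteGraph k n) λ G →
    ¬ ContainsCompleteMultipartite G s t × N ≤ edges G

{-# OPTIONS --safe #-}
module Submission where

-- Write t = L + 1 and start from the complete r-partite graph between the groups of classes of T_r(k), where
-- k - r groups consist of two classes and 2r - k of one.  One two-class group receives an extremal
-- K_{t,t}-free graph, every other one the L-regular bipartite graph y - x ∈ {0, …, L - 1} (mod m), whose
-- complete bipartite subgraphs have at most t vertices.
--
-- For the last term, pair up two-class groups with one-class groups.  In each of the two classes of the former,
-- b = ⌊L/2⌋ special vertices move to the latter group: they become adjacent to everything allowed in their
-- old group, and in the partner class only to L vertices each, with disjoint neighbourhoods.  Against the L n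
-- edges of the unmodified pair this gains b (L - b) = ⌊L²/4⌋.
--
-- A copy of K_{r+1}(t) has (r + 1) t vertices.  But the first group contains at most 2t - 1 of them, every unpaired
-- group at most t, and a pair of partners at most 2t: together at most (r + 1) t - 1.

open import Defs
open import Data.Nat
open import Data.Nat.Properties
open import Data.Nat.DivMod
open import Data.Nat.Divisibility using (divides-refl)
open import Data.Nat.Solver using (module +-*-Solver)
open import Data.Fin using (Fin; toℕ; fromℕ<; combine; remQuot)
import Data.Fin as F
import Data.Fin.Properties as F
open import Data.Fin.Properties using (toℕ<n; toℕ-fromℕ<; fromℕ<-toℕ; toℕ-injective)
open import Data.Bool using (Bool; true; false; if_then_else_)
import Data.Bool as Bool
open import Data.Empty using (⊥; ⊥-elim)
open import Data.Unit using (⊤; tt)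
open import Data.Product using (_×_; _,_; proj₁; proj₂; ∃; ∃₂; uncurry)
open import Data.Sum using (_⊎_; inj₁; inj₂)
open import Function using (_∘_; case_of_)
open import Function.Bundles using (mk⇔)
open import Relation.Nullary
open import Relation.Nullary.Decidable using (_×-dec_; _→-dec_; ¬?; dec-true; dec-false; does-⇔)
open import Relation.Binary.PropositionalEquality

-- A copy need not be induced, so one of its parts may be scattered over many classes; only the
-- vertices of a single class are forced into a common part. Hence vertices are counted group by
-- group instead of placing whole parts. A two-class group other than the first may contribute no
-- more than a single class does, namely t vertices. Being K_{t,t}-free is too weak for that, which
-- is why these groups carry the cyclic graph. The choice of b: inside a group with b special
-- vertices per class there are (n - b) L + 2 b n - b² edges, and 2 b (n - L) edges to the partner
-- are lost. The terms b n cancel and L n + b (L - b) remains, which is largest at b = ⌊L/2⌋. This b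
-- also satisfies 2 b ≤ L, so special vertices alone never exceed t. The delicate point is a group
-- that receives special vertices: it is only bounded by t + 1, so the bound 2t for partners is not
-- simply t + t. Small neighbourhoods keep a whole part out of the partner class, and disjoint ones
-- allow at most one special vertex outside the part that meets that class.

sumFin-cong : ∀ {n} {f g : Fin n → ℕ} → (∀ i → f i ≡ g i) → sumFin n f ≡ sumFin n g
sumFin-cong {zero}  f≡g = refl
sumFin-cong {suc n} f≡g = cong₂ _+_ (f≡g F.zero) (sumFin-cong (f≡g ∘ F.suc))

sumFin-mono : ∀ {n} {f g : Fin n → ℕ} → (∀ i → f i ≤ g i) → sumFin n f ≤ sumFin n g
sumFin-mono {zero}  f≤g = z≤n
sumFin-mono {suc n} f≤g = +-mono-≤ (f≤g F.zero) (sumFin-mono (f≤g ∘ F.suc))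

sumFin-const : ∀ n c → sumFin n (λ _ → c) ≡ n * c
sumFin-const zero    c = refl
sumFin-const (suc n) c = cong (c +_) (sumFin-const n c)

+-interchange : ∀ a b c d → (a + b) + (c + d) ≡ (a + c) + (b + d)
+-interchange = solve 4 (λ a b c d → (a :+ b) :+ (c :+ d) := (a :+ c) :+ (b :+ d)) refl
  where open +-*-Solver

sumFin-+ : ∀ n (f g : Fin n → ℕ) → sumFin n (λ i → f i + g i) ≡ sumFin n f + sumFin n g
sumFin-+ zero    f g = refl
sumFin-+ (suc n) f g = trans
  (cong (f F.zero + g F.zero +_) (sumFin-+ n (f ∘ F.suc) (g ∘ F.suc)))
  (+-interchange (f F.zero) (g F.zero) _ _)

sumFin-* : ∀ n (f : Fin n → ℕ) c → sumFin n (λ i → f i * c) ≡ sumFin n f * c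
sumFin-* zero    f c = refl
sumFin-* (suc n) f c = trans (cong (f F.zero * c +_) (sumFin-* n (f ∘ F.suc) c))
  (sym (*-distribʳ-+ c (f F.zero) _))

sumFin-swap : ∀ m n (f : Fin m → Fin n → ℕ) →
  sumFin m (λ i → sumFin n (f i)) ≡ sumFin n (λ j → sumFin m (λ i → f i j))
sumFin-swap zero    n f = sym (trans (sumFin-const n 0) (*-zeroʳ n))
sumFin-swap (suc m) n f = trans (cong (sumFin n (f F.zero) +_) (sumFin-swap m n (f ∘ F.suc)))
  (sym (sumFin-+ n (f F.zero) _))

term≤sumFin : ∀ {n} (f : Fin n → ℕ) i → f i ≤ sumFin n f
term≤sumFin f F.zero    = m≤m+n _ _
term≤sumFin f (F.suc i) = ≤-trans (term≤sumFin (f ∘ F.suc) i) (m≤n+m _ (f F.zero))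

-- Sums over initial segments, and counting by indicators

∑ : (n : ℕ) → (ℕ → ℕ) → ℕ
∑ n f = sumFin n (f ∘ toℕ)

∑-mono : ∀ n {f g : ℕ → ℕ} → (∀ x → x < n → f x ≤ g x) → ∑ n f ≤ ∑ n g
∑-mono n f≤g = sumFin-mono λ i → f≤g (toℕ i) (toℕ<n i)

∑-cong : ∀ n {f g : ℕ → ℕ} → (∀ x → x < n → f x ≡ g x) → ∑ n f ≡ ∑ n g
∑-cong n f≡g = sumFin-cong λ i → f≡g (toℕ i) (toℕ<n i)

∑-split : ∀ m n f → ∑ (m + n) f ≡ ∑ m f + ∑ n (λ x → f (m + x))
∑-split zero    n f = refl
∑-split (suc m) n f = trans (cong (f 0 +_) (∑-split m n (f ∘ suc))) (sym (+-assoc (f 0) _ _))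

term≤∑ : ∀ n (f : ℕ → ℕ) {x} → x < n → f x ≤ ∑ n f
term≤∑ n f x<n = subst (λ y → f y ≤ ∑ n f) (toℕ-fromℕ< x<n) (term≤sumFin (f ∘ toℕ) (fromℕ< x<n))

∑-lower : ∀ n c {f : ℕ → ℕ} → (∀ x → x < n → c ≤ f x) → n * c ≤ ∑ n f
∑-lower n c c≤f = ≤-trans (≤-reflexive (sym (sumFin-const n c))) (∑-mono n c≤f)

ι : {A : Set} → Dec A → ℕ
ι A? = ⟦ does A? ⟧

ι-yes : {A : Set} (A? : Dec A) → A → ι A? ≡ 1
ι-yes A? a = cong ⟦_⟧ (dec-true A? a)

ι-no : {A : Set} (A? : Dec A) → ¬ A → ι A? ≡ 0
ι-no A? ¬a = cong ⟦_⟧ (dec-false A? ¬a)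

ι-≤ : {A : Set} (A? : Dec A) {c : ℕ} → (A → 1 ≤ c) → ι A? ≤ c
ι-≤ (no _)  f = z≤n
ι-≤ (yes a) f = f a

ι-mono : {A B : Set} (A? : Dec A) (B? : Dec B) → (A → B) → ι A? ≤ ι B?
ι-mono A? B? f = ι-≤ A? λ a → ≤-reflexive (sym (ι-yes B? (f a)))

count : ∀ {n} {P : Fin n → Set} → (∀ e → Dec (P e)) → ℕ
count P? = sumFin _ (λ e → ι (P? e))

count-subsingleton : ∀ {n} {P : Fin n → Set} (P? : ∀ e → Dec (P e)) {Q : Set} (Q? : Dec Q) →
  (∀ {e e′} → P e → P e′ → e ≡ e′) → (∀ {e} → P e → Q) → count P? ≤ ι Q?
count-subsingleton {zero}  P? Q? unique P⇒Q = z≤n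
count-subsingleton {suc n} P? Q? unique P⇒Q with P? F.zero
... | no _  = count-subsingleton (P? ∘ F.suc) Q? (λ p p′ → F.suc-injective (unique p p′)) P⇒Q
... | yes p = ≤-reflexive (trans (cong suc rest≡0) (sym (ι-yes Q? (P⇒Q p))))
  where
  rest≡0 : count (P? ∘ F.suc) ≡ 0
  rest≡0 = trans (sumFin-cong λ e → ι-no (P? (F.suc e)) λ p′ → contradiction (unique p p′) F.0≢1+n)
                 (trans (sumFin-const n 0) (*-zeroʳ n))

-- Double counting of the pairs (e , y) with P e and h e ≡ y.
count-injection : ∀ {n m} {P : Fin n → Set} (P? : ∀ e → Dec (P e)) {Q : ℕ → Set} (Q? : ∀ y → Dec (Q y))
  (h : Fin n → ℕ) → (∀ {e} → P e → h e < m) → (∀ {e} → P e → Q (h e)) →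
  (∀ {e e′} → P e → P e′ → h e ≡ h e′ → e ≡ e′) →
  count P? ≤ ∑ m (λ y → ι (Q? y))
count-injection {n} {m} {P} P? {Q} Q? h h< hQ h-inj = begin
  count P?                                  ≤⟨ sumFin-mono atLeast1 ⟩
  sumFin n (λ e → ∑ m (λ y → ι (R? y e)))   ≡⟨ sumFin-swap n m _ ⟩
  ∑ m (λ y → count (R? y))                  ≤⟨ ∑-mono m (λ y _ → count-subsingleton (R? y) (Q? y) unique image) ⟩
  ∑ m (λ y → ι (Q? y))                      ∎
  where
  open ≤-Reasoning
  R? : ∀ y e → Dec (P e × h e ≡ y)
  R? y e = P? e ×-dec (h e ≟ y)
  unique : ∀ {y e e′} → P e × h e ≡ y → P e′ × h e′ ≡ y → e ≡ e′
  unique (p , eq) (p′ , eq′) = h-inj p p′ (trans eq (sym eq′))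
  image : ∀ {y e} → P e × h e ≡ y → Q y
  image (p , eq) = subst Q eq (hQ p)
  atLeast1 : ∀ e → ι (P? e) ≤ ∑ m (λ y → ι (R? y e))
  atLeast1 e = ι-≤ (P? e) λ p → ≤-trans (≤-reflexive (sym (ι-yes (R? (h e) e) (p , refl))))
                                        (term≤∑ m (λ y → ι (R? y e)) (h< p))

count-injection-< : ∀ {n} m {P : Fin n → Set} (P? : ∀ e → Dec (P e)) (h : Fin n → ℕ) →
  (∀ {e} → P e → h e < m) → (∀ {e e′} → P e → P e′ → h e ≡ h e′ → e ≡ e′) → count P? ≤ m
count-injection-< m P? h h< h-inj = begin
  count P?           ≤⟨ count-injection P? (λ _ → yes tt) h h< (λ _ → tt) h-inj ⟩
  ∑ m (λ _ → 1)      ≡⟨ trans (sumFin-const m 1) (*-identityʳ m) ⟩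
  m                  ∎
  where open ≤-Reasoning

count-lower : ∀ {l m} {Q : ℕ → Set} (Q? : ∀ y → Dec (Q y)) (h : ℕ → ℕ) →
  (∀ {d} → d < l → h d < m × Q (h d)) →
  (∀ {d d′} → d < l → d′ < l → h d ≡ h d′ → d ≡ d′) →
  l ≤ ∑ m (λ y → ι (Q? y))
count-lower {l} {m} Q? h hQ h-inj = begin
  l                        ≡⟨ trans (sumFin-const l 1) (*-identityʳ l) ⟨
  count {l} (λ _ → yes tt) ≤⟨ count-injection (λ _ → yes tt) Q? (h ∘ toℕ) (λ {e} _ → proj₁ (hQ (toℕ<n e))) (λ {e} _ → proj₂ (hQ (toℕ<n e)))
                                (λ {e} {e′} _ _ eq → toℕ-injective (h-inj (toℕ<n e) (toℕ<n e′) eq)) ⟩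
  ∑ m (λ y → ι (Q? y))     ∎
  where open ≤-Reasoning

-- Used with `f` counting at the two-class groups and `g` at the one-class groups, equal indices
-- being partners. Removing one index from both sums keeps the pairing, until one of the sums is
-- empty.
∑-paired-bound : ∀ q s t (f g : ℕ → ℕ) →
  (∀ i → i < q → i < s → f i + g i ≤ t + t) → (∀ i → i < q → s ≤ i → f i ≤ t) →
  (∀ j → j < s → q ≤ j → g j ≤ t) → ∑ q f + ∑ s g ≤ (q + s) * t
∑-paired-bound zero s t f g _ _ g≤t = begin
  ∑ s g              ≤⟨ ∑-mono s (λ j j<s → g≤t j j<s z≤n) ⟩
  ∑ s (λ _ → t)      ≡⟨ sumFin-const s t ⟩
  s * t              ∎
  where open ≤-Reasoning
∑-paired-bound (suc q) zero t f g _ f≤t _ = begin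
  ∑ (suc q) f + 0          ≡⟨ +-identityʳ _ ⟩
  ∑ (suc q) f              ≤⟨ ∑-mono (suc q) (λ i i<q → f≤t i i<q z≤n) ⟩
  ∑ (suc q) (λ _ → t)      ≡⟨ sumFin-const (suc q) t ⟩
  suc q * t                ≡⟨ cong (_* t) (+-identityʳ (suc q)) ⟨
  (suc q + 0) * t          ∎
  where open ≤-Reasoning
∑-paired-bound (suc q) (suc s) t f g f+g≤2t f≤t g≤t = begin
  (f 0 + ∑ q (f ∘ suc)) + (g 0 + ∑ s (g ∘ suc))  ≡⟨ +-interchange (f 0) _ (g 0) _ ⟩
  (f 0 + g 0) + (∑ q (f ∘ suc) + ∑ s (g ∘ suc))  ≤⟨ +-mono-≤ (f+g≤2t 0 z<s z<s)
      (∑-paired-bound q s t (f ∘ suc) (g ∘ suc) (λ i i<q i<s → f+g≤2t (suc i) (s<s i<q) (s<s i<s))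
        (λ i i<q s≤i → f≤t (suc i) (s<s i<q) (s≤s s≤i)) (λ j j<s q≤j → g≤t (suc j) (s<s j<s) (s≤s q≤j))) ⟩
  t + t + (q + s) * t                            ≡⟨ +-assoc t t _ ⟩
  (suc (suc (q + s))) * t                        ≡⟨ cong (λ u → suc u * t) (+-suc q s) ⟨
  (suc q + suc s) * t                            ∎
  where open ≤-Reasoning

does-true : {A : Set} (A? : Dec A) → does A? ≡ true → A
does-true (yes a) _ = a

-- Displacements modulo m and complete bipartite subgraphs of the cyclic graph

module _ (m : ℕ) .{{_ : NonZero m}} where

  %-cancel : ∀ {a b} u v → a < m → b < m → a + u * m ≡ b + v * m → a ≡ b
  %-cancel {a} {b} u v a<m b<m eq = begin
    a                ≡⟨ m<n⇒m%n≡m a<m ⟨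
    a % m            ≡⟨ [m+kn]%n≡m%n a u m ⟨
    (a + u * m) % m  ≡⟨ cong (_% m) eq ⟩
    (b + v * m) % m  ≡⟨ [m+kn]%n≡m%n b v m ⟩
    b % m            ≡⟨ m<n⇒m%n≡m b<m ⟩
    b                ∎
    where open ≡-Reasoning

  -- The residue of y - x modulo m, for x , y < m.
  disp : ℕ → ℕ → ℕ
  disp x y = (y + (m ∸ x)) % m

  disp<m : ∀ x y → disp x y < m
  disp<m x y = m%n<n (y + (m ∸ x)) m

  -- The congruence of `x + disp x y` and `y`, with multiples of `m` on both sides: such equations
  -- can be added and cancelled without subtraction, and `%-cancel` then returns to residues.
  disp-spec : ∀ {x} y → x < m → ∃₂ λ u v → x + disp x y + u * m ≡ y + v * m
  disp-spec {x} y x<m = (y + (m ∸ x)) / m , 1 , (begin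
    x + disp x y + (y + (m ∸ x)) / m * m    ≡⟨ +-assoc x _ _ ⟩
    x + (disp x y + (y + (m ∸ x)) / m * m)  ≡⟨ cong (x +_) (m≡m%n+[m/n]*n (y + (m ∸ x)) m) ⟨
    x + (y + (m ∸ x))                       ≡⟨ solve 3 (λ x y z → x :+ (y :+ z) := y :+ (x :+ z :+ con 0)) refl x y (m ∸ x) ⟩
    y + (x + (m ∸ x) + 0)                   ≡⟨ cong (λ z → y + (z + 0)) (m+[n∸m]≡n (<⇒≤ x<m)) ⟩
    y + 1 * m                               ∎)
    where
    open ≡-Reasoning
    open +-*-Solver

  disp-unique : ∀ {x y d} u v → x < m → d < m → x + d + u * m ≡ y + v * m → disp x y ≡ d
  disp-unique {x} {y} {d} u v x<m d<m eq with disp-spec y x<m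
  ... | u′ , v′ , eq′ = %-cancel (u′ + v) (u + v′) (disp<m x y) d<m (+-cancelˡ-≡ x _ _ (begin
    x + (disp x y + (u′ + v) * m)    ≡⟨ regroup x (disp x y) u′ v m ⟩
    (x + disp x y + u′ * m) + v * m  ≡⟨ cong (_+ v * m) eq′ ⟩
    (y + v′ * m) + v * m             ≡⟨ solve 4 (λ y v v′ m → (y :+ v′ :* m) :+ v :* m := (y :+ v :* m) :+ v′ :* m) refl y v v′ m ⟩
    (y + v * m) + v′ * m             ≡⟨ cong (_+ v′ * m) eq ⟨
    (x + d + u * m) + v′ * m         ≡⟨ regroup x d u v′ m ⟨
    x + (d + (u + v′) * m)           ∎))
    where
    open ≡-Reasoning
    open +-*-Solver
    regroup : ∀ x d u v m → x + (d + (u + v) * m) ≡ (x + d + u * m) + v * m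
    regroup = solve 5 (λ x d u v m → x :+ (d :+ (u :+ v) :* m) := (x :+ d :+ u :* m) :+ v :* m) refl

  disp-injectiveʳ : ∀ {x y y′} → x < m → y < m → y′ < m → disp x y ≡ disp x y′ → y ≡ y′
  disp-injectiveʳ {x} {y} {y′} x<m y<m y′<m eq with disp-spec y x<m | disp-spec y′ x<m
  ... | u , v , e | u′ , v′ , e′ = %-cancel (v + u′) (v′ + u) y<m y′<m (begin
    y + (v + u′) * m                 ≡⟨ regroup y v u′ m ⟩
    y + v * m + u′ * m               ≡⟨ cong (_+ u′ * m) e ⟨
    x + disp x y + u * m + u′ * m    ≡⟨ cong (λ d → x + d + u * m + u′ * m) eq ⟩
    x + disp x y′ + u * m + u′ * m   ≡⟨ solve 4 (λ z u u′ m → z :+ u :* m :+ u′ :* m := z :+ u′ :* m :+ u :* m) refl (x + disp x y′) u u′ m ⟩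
    x + disp x y′ + u′ * m + u * m   ≡⟨ cong (_+ u * m) e′ ⟩
    y′ + v′ * m + u * m              ≡⟨ regroup y′ v′ u m ⟨
    y′ + (v′ + u) * m                ∎)
    where
    open ≡-Reasoning
    open +-*-Solver
    regroup : ∀ y v u m → y + (v + u) * m ≡ y + v * m + u * m
    regroup = solve 4 (λ y v u m → y :+ (v :+ u) :* m := y :+ v :* m :+ u :* m) refl

  disp-injectiveˡ : ∀ {x x′ y} → x < m → x′ < m → disp x y ≡ disp x′ y → x ≡ x′
  disp-injectiveˡ {x} {x′} {y} x<m x′<m eq with disp-spec y x<m | disp-spec y x′<m
  ... | u , v , e | u′ , v′ , e′ = %-cancel (u + v′) (u′ + v) x<m x′<m (+-cancelˡ-≡ (disp x y) _ _ (begin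
    disp x y + (x + (u + v′) * m)     ≡⟨ regroup (disp x y) x u v′ m ⟩
    x + disp x y + u * m + v′ * m     ≡⟨ cong (_+ v′ * m) e ⟩
    y + v * m + v′ * m                ≡⟨ solve 4 (λ z u u′ m → z :+ u :* m :+ u′ :* m := z :+ u′ :* m :+ u :* m) refl y v v′ m ⟩
    y + v′ * m + v * m                ≡⟨ cong (_+ v * m) e′ ⟨
    x′ + disp x′ y + u′ * m + v * m   ≡⟨ cong (λ d → x′ + d + u′ * m + v * m) eq ⟨
    x′ + disp x y + u′ * m + v * m    ≡⟨ regroup (disp x y) x′ u′ v m ⟨
    disp x y + (x′ + (u′ + v) * m)    ∎))
    where
    open ≡-Reasoning
    open +-*-Solver
    regroup : ∀ d x u v m → d + (x + (u + v) * m) ≡ x + d + u * m + v * m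
    regroup = solve 5 (λ d x u v m → d :+ (x :+ (u :+ v) :* m) := x :+ d :+ u :* m :+ v :* m) refl

  -- Both sums are congruent to q + q₀ - p - p₀ modulo `m`; since both lie below `m`, they are
  -- equal.
  disp-exchange : ∀ {p p₀ q q₀} → p < m → p₀ < m →
    disp p q₀ + disp p₀ q < m → disp p q + disp p₀ q₀ < m →
    disp p q₀ + disp p₀ q ≡ disp p q + disp p₀ q₀
  disp-exchange {p} {p₀} {q} {q₀} p<m p₀<m i+j<m d+j₀<m
    with disp-spec q₀ p<m | disp-spec q p₀<m | disp-spec q p<m | disp-spec q₀ p₀<m
  ... | u₁ , v₁ , e₁ | u₂ , v₂ , e₂ | u₃ , v₃ , e₃ | u₄ , v₄ , e₄ =
    %-cancel (u₁ + u₂ + (v₃ + v₄)) (u₃ + u₄ + (v₁ + v₂)) i+j<m d+j₀<m (+-cancelˡ-≡ (p + p₀) _ _ (begin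
      p + p₀ + (disp p q₀ + disp p₀ q + (u₁ + u₂ + (v₃ + v₄)) * m)
        ≡⟨ regroup p p₀ (disp p q₀) (disp p₀ q) u₁ u₂ (v₃ + v₄) m ⟩
      (p + disp p q₀ + u₁ * m) + (p₀ + disp p₀ q + u₂ * m) + (v₃ + v₄) * m
        ≡⟨ cong₂ (λ a b → a + b + (v₃ + v₄) * m) e₁ e₂ ⟩
      (q₀ + v₁ * m) + (q + v₂ * m) + (v₃ + v₄) * m
        ≡⟨ solve 7 (λ q₀ q v₁ v₂ v₃ v₄ m → (q₀ :+ v₁ :* m) :+ (q :+ v₂ :* m) :+ (v₃ :+ v₄) :* m
                     := (q :+ v₃ :* m) :+ (q₀ :+ v₄ :* m) :+ (v₁ :+ v₂) :* m) refl q₀ q v₁ v₂ v₃ v₄ m ⟩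
      (q + v₃ * m) + (q₀ + v₄ * m) + (v₁ + v₂) * m
        ≡⟨ cong₂ (λ a b → a + b + (v₁ + v₂) * m) e₃ e₄ ⟨
      (p + disp p q + u₃ * m) + (p₀ + disp p₀ q₀ + u₄ * m) + (v₁ + v₂) * m
        ≡⟨ regroup p p₀ (disp p q) (disp p₀ q₀) u₃ u₄ (v₁ + v₂) m ⟨
      p + p₀ + (disp p q + disp p₀ q₀ + (u₃ + u₄ + (v₁ + v₂)) * m) ∎))
    where
    open ≡-Reasoning
    open +-*-Solver
    regroup : ∀ p p₀ i j u u′ v m → p + p₀ + (i + j + (u + u′ + v) * m) ≡ (p + i + u * m) + (p₀ + j + u′ * m) + v * m
    regroup = solve 8 (λ p p₀ i j u u′ v m → p :+ p₀ :+ (i :+ j :+ (u :+ u′ :+ v) :* m)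
      := (p :+ i :+ u :* m) :+ (p₀ :+ j :+ u′ :* m) :+ v :* m) refl

  disp-row : ∀ {L x} → L ≤ m → x < m → L ≤ ∑ m (λ y → ι (disp x y <? L))
  disp-row {L} {x} L≤m x<m = count-lower (λ y → disp x y <? L) target
    (λ d<L → m%n<n _ m , subst (_< L) (sym (disp-target d<L)) d<L)
    (λ d<L d′<L eq → trans (sym (disp-target d<L)) (trans (cong (disp x) eq) (disp-target d′<L)))
    where
    target : ℕ → ℕ
    target d = (x + d) % m
    disp-target : ∀ {d} → d < L → disp x (target d) ≡ d
    disp-target {d} d<L = disp-unique 0 ((x + d) / m) x<m (<-≤-trans d<L L≤m)
      (trans (+-identityʳ (x + d)) (m≡m%n+[m/n]*n (x + d) m))

-- In the bipartite graph x ∼ y ⇔ disp x y < L a complete bipartite subgraph with both sides nonempty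
-- has at most L + 1 vertices.  For fixed p₀ and q₀ the numbers i = disp p q₀ and j = disp p₀ q satisfy
-- j₀ ≤ i + j < j₀ + L with j₀ = disp p₀ q₀, so i avoids the residue of j₀ + L - j modulo L + 1.
module _ (L j₀ : ℕ) where

  avoided : ℕ → ℕ
  avoided j = if does (j₀ ≤? j) then j₀ + L ∸ j else j₀ ∸ suc j

  -- The two cases make `j + avoided j` equal to j₀ + L or to j₀ - 1, the numbers just outside the
  -- interval [j₀ , j₀ + L). They are congruent modulo L + 1, so one value serves to miss the whole
  -- interval.
  avoided-spec : ∀ {j} → j < L → (j₀ ≤ j × j + avoided j ≡ j₀ + L) ⊎ suc (j + avoided j) ≡ j₀
  avoided-spec {j} j<L with j₀ ≤? j
  ... | yes j₀≤j rewrite dec-true (j₀ ≤? j) j₀≤j = inj₁ (j₀≤j , m+[n∸m]≡n (≤-trans (<⇒≤ j<L) (m≤n+m L j₀)))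
  ... | no  j₀≰j rewrite dec-false (j₀ ≤? j) j₀≰j = inj₂ (m+[n∸m]≡n (≰⇒> j₀≰j))

  avoided≤L : j₀ < L → ∀ {j} → j < L → avoided j ≤ L
  avoided≤L j₀<L {j} j<L with avoided-spec j<L
  ... | inj₁ (j₀≤j , eq) = +-cancelˡ-≤ j _ _ (≤-trans (≤-reflexive eq) (+-monoˡ-≤ L j₀≤j))
  ... | inj₂ eq = ≤-trans (m≤n+m (avoided j) (suc j)) (≤-trans (≤-reflexive eq) (<⇒≤ j₀<L))

  avoided-mixed : ∀ {j j′ a} → j < L → j + a ≡ j₀ + L → suc (j′ + a) ≢ j₀
  avoided-mixed {j} {j′} {a} j<L eq eq′ = <-irrefl eq (begin-strict
    j + a     <⟨ +-mono-<-≤ j<L (≤-trans (m≤n+m a (suc j′)) (≤-reflexive eq′)) ⟩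
    L + j₀    ≡⟨ +-comm L j₀ ⟩
    j₀ + L    ∎)
    where open ≤-Reasoning

  avoided-injective : ∀ {j j′} → j < L → j′ < L → avoided j ≡ avoided j′ → j ≡ j′
  avoided-injective {j} {j′} j<L j′<L a≡a′ with avoided-spec j<L | avoided-spec j′<L
  ... | inj₁ (_ , eq) | inj₁ (_ , eq′) = +-cancelʳ-≡ (avoided j) j j′ (trans eq (sym (trans (cong (j′ +_) a≡a′) eq′)))
  ... | inj₂ eq       | inj₂ eq′       = +-cancelʳ-≡ (avoided j) j j′ (suc-injective (trans eq (sym (trans (cong (suc ∘ (j′ +_)) a≡a′) eq′))))
  ... | inj₁ (_ , eq) | inj₂ eq′       = contradiction (trans (cong (suc ∘ (j′ +_)) a≡a′) eq′) (avoided-mixed j<L eq)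
  ... | inj₂ eq       | inj₁ (_ , eq′) = contradiction (trans (cong (suc ∘ (j +_)) (sym a≡a′)) eq) (avoided-mixed j′<L eq′)

  avoided-avoids : ∀ {i j d} → j < L → d < L → i + j ≡ d + j₀ → i ≢ avoided j
  avoided-avoids {i} {j} {d} j<L d<L eq refl with avoided-spec j<L
  ... | inj₁ (_ , eq′) = <-irrefl (+-cancelʳ-≡ j₀ d L (trans (sym eq) (trans (+-comm i j) (trans eq′ (+-comm j₀ L))))) d<L
  ... | inj₂ eq′ = <-irrefl refl (begin-strict
    j₀            ≤⟨ m≤n+m j₀ d ⟩
    d + j₀        ≡⟨ eq ⟨
    i + j         ≡⟨ +-comm i j ⟩
    j + i         <⟨ ≤-reflexive eq′ ⟩
    j₀            ∎)
    where open ≤-Reasoning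

-- Left vertices are labelled by their displacement to `q₀`, right vertices by the label that they
-- forbid on the left. These labels are distinct numbers up to `L`. The condition `L + L ≤ m` keeps
-- sums of two displacements below `m`, so that `disp-exchange` applies.
cyclic-biclique : ∀ {N L m} .{{_ : NonZero m}} → L + L ≤ m →
  {P : Fin N → Set} (P? : ∀ e → Dec (P e)) (side : Fin N → Bool) (pos : Fin N → ℕ) →
  (∀ {e} → P e → pos e < m) →
  (∀ {e e′} → P e → P e′ → side e ≡ side e′ → pos e ≡ pos e′ → e ≡ e′) →
  (∀ {e e′} → P e → P e′ → side e ≡ false → side e′ ≡ true → disp m (pos e) (pos e′) < L) →
  (∃ λ e → P e × side e ≡ false) → (∃ λ e → P e × side e ≡ true) → count P? ≤ suc L
cyclic-biclique {N} {L} {m} 2L≤m {P} P? side pos pos<m inj near (e₀ , Pe₀ , left) (f₀ , Pf₀ , right) =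
  count-injection-< (suc L) P? h (λ {e} Pe → s≤s (label≤L e (side e) refl Pe))
    (λ {e} {e′} Pe Pe′ eq → label-injective e e′ (side e) (side e′) refl refl Pe Pe′ eq)
  where
  p₀ = pos e₀
  q₀ = pos f₀
  j₀ = disp m p₀ q₀
  j₀<L = near Pe₀ Pf₀ left right

  label : Bool → ℕ → ℕ
  label false x = disp m x q₀
  label true  y = avoided L j₀ (disp m p₀ y)

  h : Fin N → ℕ
  h e = label (side e) (pos e)

  label≤L : ∀ e σ → side e ≡ σ → P e → label σ (pos e) ≤ L
  label≤L e false σ Pe = <⇒≤ (near Pe Pf₀ σ right)
  label≤L e true  σ Pe = avoided≤L L j₀ j₀<L (near Pe₀ Pe left σ)

  disjoint : ∀ {e f} → P e → P f → side e ≡ false → side f ≡ true → label false (pos e) ≢ label true (pos f)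
  disjoint Pe Pf σ τ = avoided-avoids L j₀ j<L d<L
    (disp-exchange m (pos<m Pe) (pos<m Pe₀) (<-≤-trans (+-mono-< i<L j<L) 2L≤m) (<-≤-trans (+-mono-< d<L j₀<L) 2L≤m))
    where
    i<L = near Pe Pf₀ σ right
    j<L = near Pe₀ Pf left τ
    d<L = near Pe Pf σ τ

  label-injective : ∀ e e′ σ τ → side e ≡ σ → side e′ ≡ τ → P e → P e′ → label σ (pos e) ≡ label τ (pos e′) → e ≡ e′
  label-injective e e′ false false σ τ Pe Pe′ eq = inj Pe Pe′ (trans σ (sym τ)) (disp-injectiveˡ m (pos<m Pe) (pos<m Pe′) eq)
  label-injective e e′ true  true  σ τ Pe Pe′ eq = inj Pe Pe′ (trans σ (sym τ))
    (disp-injectiveʳ m (pos<m Pe₀) (pos<m Pe) (pos<m Pe′) (avoided-injective L j₀ (near Pe₀ Pe left σ) (near Pe₀ Pe′ left τ) eq))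
  label-injective e e′ false true  σ τ Pe Pe′ eq = contradiction eq (disjoint Pe Pe′ σ τ)
  label-injective e e′ true  false σ τ Pe Pe′ eq = contradiction (sym eq) (disjoint Pe′ Pe τ σ)

-- The construction

record Vertex : Set where
  constructor vertex
  field
    group : ℕ
    side  : Bool
    pos   : ℕ
open Vertex

-- L = t - 1, and r = 1 + q + s groups: the group 0 and the groups 1 + i (i < q) consist of two classes,
-- told apart by the side, the groups 1 + q + j (j < s) of a single class.  For i < q ⊓ s the group 1 + q + i
-- is the partner of 1 + i, and the last b vertices of both classes of 1 + i are special.
module Construction (L q s n b : ℕ) .{{_ : NonZero L}} (b<n : b < n) (B : ℕ → ℕ → Bool) where

  r k : ℕ
  r = suc (q + s)
  k = suc q + r

  -- The test `i < s` says that the one-class group `1 + q + i` exists, so that `1 + i` has a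
  -- partner. That `1 + i` itself has two classes, `i < q`, is tested separately in `Across` and
  -- `special?`.
  specials : ℕ → ℕ
  specials i = if does (i <? s) then b else 0

  ordinary : ℕ → ℕ
  ordinary i = n ∸ specials i

  specials≤b : ∀ i → specials i ≤ b
  specials≤b i with does (i <? s)
  ... | true  = ≤-refl
  ... | false = z≤n

  ordinary+specials : ∀ i → ordinary i + specials i ≡ n
  ordinary+specials i = m∸n+n≡m (≤-trans (specials≤b i) (<⇒≤ b<n))

  ordinary-nonZero : ∀ i → NonZero (ordinary i)
  ordinary-nonZero i = >-nonZero (m<n⇒0<n∸m (≤-<-trans (specials≤b i) b<n))

  distance : ℕ → ℕ → ℕ → ℕ
  distance i = disp (ordinary i) {{ordinary-nonZero i}}

  -- The implications hold vacuously at a special vertex, which is thereby joined to the whole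
  -- opposite class. The cyclic graph is taken modulo `ordinary i`, so the remaining vertices still
  -- have degree L among themselves.
  Within : ℕ → ℕ → ℕ → Set
  Within zero    x y = B x y ≡ true
  Within (suc i) x y = x < ordinary i → y < ordinary i → distance i x y < L

  SameGroup : ℕ → Bool → ℕ → Bool → ℕ → Set
  SameGroup g false x true  y = Within g x y
  SameGroup g true  x false y = Within g y x
  SameGroup g false x false y = ⊥
  SameGroup g true  x true  y = ⊥

  -- The special vertices of 1 + i are numbered by owner; the one with number c is joined to the
  -- interval [c L , c L + L) of the partner.
  owner : ℕ → Bool → ℕ → ℕ
  owner i σ x = (if σ then b else 0) + (x ∸ ordinary i)

  sideOffset≤b : ∀ σ → (if σ then b else 0) ≤ b
  sideOffset≤b true  = ≤-refl
  sideOffset≤b false = z≤n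

  -- A restriction only for a special vertex against the partner class, and vacuous otherwise;
  -- `Adjacent` can thus require it in both directions for every pair of vertices.
  Across : ℕ → Bool → ℕ → ℕ → ℕ → Set
  Across zero    σ x h y = ⊤
  Across (suc i) σ x h y = i < q → h ≡ suc (q + i) → ordinary i ≤ x → y / L ≡ owner i σ x

  Adjacent : Vertex → Vertex → Set
  Adjacent (vertex g σ x) (vertex h τ y) =
    (g ≡ h → SameGroup g σ x τ y) × Across g σ x h y × Across h τ y g x

  within? : ∀ g x y → Dec (Within g x y)
  within? zero    x y = B x y Bool.≟ true
  within? (suc i) x y = (x <? ordinary i) →-dec ((y <? ordinary i) →-dec (distance i x y <? L))

  sameGroup? : ∀ g σ x τ y → Dec (SameGroup g σ x τ y)
  sameGroup? g false x true  y = within? g x y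
  sameGroup? g true  x false y = within? g y x
  sameGroup? g false x false y = no λ ()
  sameGroup? g true  x true  y = no λ ()

  across? : ∀ g σ x h y → Dec (Across g σ x h y)
  across? zero    σ x h y = yes tt
  across? (suc i) σ x h y = (i <? q) →-dec ((h ≟ suc (q + i)) →-dec ((ordinary i ≤? x) →-dec (y / L ≟ owner i σ x)))

  adjacent? : ∀ u v → Dec (Adjacent u v)
  adjacent? (vertex g σ x) (vertex h τ y) =
    ((g ≟ h) →-dec sameGroup? g σ x τ y) ×-dec (across? g σ x h y ×-dec across? h τ y g x)

  SameGroup-sym : ∀ g σ x τ y → SameGroup g σ x τ y → SameGroup g τ y σ x
  SameGroup-sym g false x true  y w = w
  SameGroup-sym g true  x false y w = w

  Adjacent-sym : ∀ {u v} → Adjacent u v → Adjacent v u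
  Adjacent-sym {vertex g σ x} {vertex h τ y} (same , out , back) = same′ , back , out
    where
    same′ : h ≡ g → SameGroup h τ y σ x
    same′ refl = SameGroup-sym g σ x τ y (same refl)

  Adjacent-side : ∀ {u v} → Adjacent u v → group u ≡ group v → side u ≢ side v
  Adjacent-side {vertex g false x} {vertex g false y} (same , _) refl refl = same refl
  Adjacent-side {vertex g true  x} {vertex g true  y} (same , _) refl refl = same refl

  -- Residues modulo `r` are the parts of the Turán graph as `turanNumber` realises it. As k = (q +
  -- 1) + r, the classes `a` and `a + r` with a ≤ q form the two-class groups.
  classVertex : ℕ → ℕ → Vertex
  classVertex a x = vertex (a % r) (does (r ≤? a)) x

  toVertex : Fin k → Fin n → Vertex
  toVertex i x = classVertex (toℕ i) (toℕ x)

  graph : KPartiteGraph k n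
  graph = record
    { adj       = λ i x j y → does (adjacent? (toVertex i x) (toVertex j y))
    ; symmetric = λ i x j y → does-⇔ (mk⇔ Adjacent-sym Adjacent-sym) (adjacent? (toVertex i x) (toVertex j y)) (adjacent? (toVertex j y) (toVertex i x))
    ; partite   = λ i x j y e i≡j → Adjacent-side (does-true (adjacent? (toVertex i x) (toVertex j y)) e)
        (cong (λ a → toℕ a % r) i≡j) (cong (λ a → does (r ≤? toℕ a)) i≡j)
    }

  data ClassView (a : ℕ) : Set where
    first  : a < r → a % r ≡ a → does (r ≤? a) ≡ false → ClassView a
    second : ∀ g → g ≤ q → a ≡ g + r → a % r ≡ g → does (r ≤? a) ≡ true → ClassView a

  classView : ∀ a → a < k → ClassView a
  classView a a<k with a <? r
  ... | yes a<r = first a<r (m<n⇒m%n≡m a<r) (dec-false (r ≤? a) (<⇒≱ a<r))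
  ... | no  a≮r = second (a ∸ r) a∸r≤q (sym (m∸n+n≡m r≤a)) (trans (cong (_% r) (sym (m∸n+n≡m r≤a)))
      (trans ([m+n]%n≡m%n (a ∸ r) r) (m<n⇒m%n≡m (s≤s (≤-trans a∸r≤q (m≤m+n q s)))))) (dec-true (r ≤? a) r≤a)
    where
    r≤a : r ≤ a
    r≤a = ≮⇒≥ a≮r
    a∸r≤q : a ∸ r ≤ q
    a∸r≤q = ≤-trans (∸-monoˡ-≤ r (≤-pred a<k)) (≤-reflexive (m+n∸n≡m q r))

  class-injective : ∀ {a c} → a < k → c < k → a % r ≡ c % r → does (r ≤? a) ≡ does (r ≤? c) → a ≡ c
  class-injective {a} {c} a<k c<k eq σ with classView a a<k | classView c c<k
  ... | first _ e _        | first _ e′ _        = trans (sym e) (trans eq e′)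
  ... | second _ _ a≡ e _  | second _ _ c≡ e′ _  = trans a≡ (trans (cong (_+ r) (trans (sym e) (trans eq e′))) (sym c≡))
  ... | first _ _ τ        | second _ _ _ _ τ′   = case trans (sym τ) (trans σ τ′) of λ ()
  ... | second _ _ _ _ τ   | first _ _ τ′        = case trans (sym τ) (trans σ τ′) of λ ()

  class-side-true : ∀ {a} → a < k → does (r ≤? a) ≡ true → a % r ≤ q
  class-side-true {a} a<k σ with classView a a<k
  ... | first _ _ τ           = case trans (sym τ) σ of λ ()
  ... | second g g≤q _ e _    = ≤-trans (≤-reflexive e) g≤q

  toVertex-injective : ∀ {i x j y} → toVertex i x ≡ toVertex j y → (i , x) ≡ (j , y)
  toVertex-injective {i} {x} {j} {y} eq = cong₂ _,_
    (toℕ-injective (class-injective (toℕ<n i) (toℕ<n j) (cong group eq) (cong side eq)))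
    (toℕ-injective (cong pos eq))

-- Absence of a copy of K_{r+1}(t)

module Freeness (L q s n b : ℕ) .{{L≢0 : NonZero L}} (b<n : b < n) (B : ℕ → ℕ → Bool)
  (2b≤L : b + b ≤ L) (2L≤n∸b : L + L ≤ n ∸ b)
  (K-free : ∀ (f g : Fin (suc L) → ℕ) → (∀ p → f p < n) → (∀ p → g p < n) →
            (∀ {p p′} → f p ≡ f p′ → p ≡ p′) → (∀ {p p′} → g p ≡ g p′ → p ≡ p′) →
            ¬ (∀ p p′ → B (f p) (g p′) ≡ true))
  where

  open Construction L q s n b b<n B

  t : ℕ
  t = suc L

  special? : ∀ i x → Dec (i < q × ordinary i ≤ x)
  special? i x = (i <? q) ×-dec (ordinary i ≤? x)

  -- The group in which a vertex is counted: a special vertex behaves like a member of the partner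
  -- group, since it misses almost all of that class.
  location : Vertex → ℕ
  location (vertex zero    σ x) = zero
  location (vertex (suc i) σ x) = if does (special? i x) then suc (q + i) else suc i

  location-special : ∀ i σ x → i < q → ordinary i ≤ x → location (vertex (suc i) σ x) ≡ suc (q + i)
  location-special i σ x i<q ≤x rewrite dec-true (special? i x) (i<q , ≤x) = refl

  location-ordinary : ∀ i σ x → ¬ (i < q × ordinary i ≤ x) → location (vertex (suc i) σ x) ≡ suc i
  location-ordinary i σ x ¬sp rewrite dec-false (special? i x) ¬sp = refl

  location≡0 : ∀ u → location u ≡ 0 → group u ≡ 0
  location≡0 (vertex zero σ x) eq = refl
  location≡0 (vertex (suc i) σ x) eq with special? i x
  ... | yes (i<q , ≤x) = contradiction (trans (sym eq) (location-special i σ x i<q ≤x)) 0≢1+n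
  ... | no  ¬sp        = contradiction (trans (sym eq) (location-ordinary i σ x ¬sp)) 0≢1+n

  location-pair : ∀ {i} → i < q → ∀ u → location u ≡ suc i → group u ≡ suc i × pos u < ordinary i
  location-pair {i} i<q (vertex (suc j) σ x) eq with special? j x
  ... | yes (j<q , ≤x) = contradiction
    (≤-trans (m≤m+n q j) (≤-reflexive (suc-injective (trans (sym (location-special j σ x j<q ≤x)) eq)))) (<⇒≱ i<q)
  ... | no ¬sp with refl ← trans (sym (location-ordinary j σ x ¬sp)) eq = refl , ≰⇒> λ ≤x → ¬sp (i<q , ≤x)

  IsSpecial : ℕ → Vertex → Set
  IsSpecial j u = group u ≡ suc j × j < q × ordinary j ≤ pos u

  location-single : ∀ j u → location u ≡ suc (q + j) → group u ≡ suc (q + j) ⊎ IsSpecial j u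
  location-single j (vertex (suc i) σ x) eq with special? i x
  ... | no ¬sp = inj₁ (trans (sym (location-ordinary i σ x ¬sp)) eq)
  ... | yes (i<q , ≤x)
    with refl ← +-cancelˡ-≡ q i j (suc-injective (trans (sym (location-special i σ x i<q ≤x)) eq)) = inj₂ (refl , i<q , ≤x)

  special⇒<s : ∀ i x → x < n → ordinary i ≤ x → i < s
  special⇒<s i x x<n ≤x with i <? s
  ... | yes i<s = i<s
  ... | no i≮s rewrite dec-false (i <? s) i≮s = contradiction ≤x (<⇒≱ x<n)

  location<r : ∀ u → group u < r → pos u < n → location u < r
  location<r (vertex zero    σ x) g<r x<n = z<s
  location<r (vertex (suc i) σ x) g<r x<n with special? i x
  ... | no ¬sp rewrite location-ordinary i σ x ¬sp = g<r
  ... | yes (i<q , ≤x) rewrite location-special i σ x i<q ≤x = s<s (+-monoʳ-< q (special⇒<s i x x<n ≤x))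

  -- An injective family v of vertices, indexed by the disjoint parts of a complete multipartite graph.
  module Copy {N M : ℕ} (part : Fin N → Fin M) (index : Fin N → Fin t) (member : Fin M → Fin t → Fin N)
    (part-member : ∀ a p → part (member a p) ≡ a) (index-member : ∀ a p → index (member a p) ≡ p)
    (part-index-injective : ∀ {e e′} → part e ≡ part e′ → index e ≡ index e′ → e ≡ e′)
    (v : Fin N → Vertex) (v-injective : ∀ {e e′} → v e ≡ v e′ → e ≡ e′)
    (group<r : ∀ e → group (v e) < r) (side-true : ∀ e → side (v e) ≡ true → group (v e) ≤ q)
    (pos<n : ∀ e → pos (v e) < n)
    (adjacent : ∀ {e e′} → part e ≢ part e′ → Adjacent (v e) (v e′))
    where

    -- Different parts are completely joined, whereas a class spans no edge. The converse fails, as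
    -- a part may meet several classes.
    same-class⇒same-part : ∀ {e e′} → group (v e) ≡ group (v e′) → side (v e) ≡ side (v e′) → part e ≡ part e′
    same-class⇒same-part {e} {e′} g σ with part e F.≟ part e′
    ... | yes eq = eq
    ... | no neq = contradiction σ (Adjacent-side (adjacent neq) g)

    vertex-injective : ∀ {e e′} → group (v e) ≡ group (v e′) → side (v e) ≡ side (v e′) → pos (v e) ≡ pos (v e′) → e ≡ e′
    vertex-injective {e} {e′} g σ x = v-injective (≡-vertex (v e) (v e′) g σ x)
      where
      ≡-vertex : ∀ u u′ → group u ≡ group u′ → side u ≡ side u′ → pos u ≡ pos u′ → u ≡ u′
      ≡-vertex u u′ refl refl refl = refl

    module _ {P : Fin N → Set} (P? : ∀ e → Dec (P e)) where

      same-part-bound : (∀ {e e′} → P e → P e′ → part e ≡ part e′) → count P? ≤ t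
      same-part-bound same = count-injection-< t P? (toℕ ∘ index) (λ {e} _ → toℕ<n (index e))
        λ Pe Pe′ eq → part-index-injective (same Pe Pe′) (toℕ-injective eq)

      missing-member-bound : ∀ a p₀ → (∀ {e} → P e → part e ≡ a) → ¬ P (member a p₀) → count P? ≤ L
      missing-member-bound a p₀ inPart ¬P₀ = count-injection-< L P? h
        (λ {e} Pe → subst (_< L) (sym (h-index Pe)) (toℕ<n _))
        λ Pe Pe′ eq → part-index-injective (trans (inPart Pe) (sym (inPart Pe′)))
          (F.punchOut-injective (≢index Pe) (≢index Pe′) (toℕ-injective (trans (sym (h-index Pe)) (trans eq (h-index Pe′)))))
        where
        h′ : ∀ p → Dec (p₀ ≡ p) → ℕ
        -- A placeholder: no `e` with `P e` has index `p₀`.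
        h′ p (yes _)  = 0
        h′ p (no neq) = toℕ (F.punchOut neq)
        h : Fin N → ℕ
        h e = h′ (index e) (p₀ F.≟ index e)
        ≢index : ∀ {e} → P e → p₀ ≢ index e
        ≢index Pe refl = ¬P₀ (subst P (part-index-injective (trans (inPart Pe) (sym (part-member a _))) (sym (index-member a _))) Pe)
        h-index : ∀ {e} (Pe : P e) → h e ≡ toℕ (F.punchOut (≢index Pe))
        h-index {e} Pe with p₀ F.≟ index e
        ... | yes eq = contradiction eq (≢index Pe)
        ... | no neq = cong toℕ (F.punchOut-cong p₀ refl)

      full-or-bound : (∀ {e e′} → P e → P e′ → part e ≡ part e′) → (∃ λ a → ∀ p → P (member a p)) ⊎ count P? ≤ L
      full-or-bound same with F.any? (λ a → F.all? (λ p → P? (member a p)))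
      ... | yes full = inj₁ full
      ... | no ¬full with F.any? P?
      ...   | no ¬P = inj₂ (count-injection-< L P? (λ _ → 0) (λ Pe → contradiction (_ , Pe) ¬P) (λ Pe → contradiction (_ , Pe) ¬P))
      ...   | yes (e₀ , Pe₀) with F.¬∀⟶∃¬ t (λ p → P (member (part e₀) p)) (λ p → P? (member (part e₀) p)) (λ all → ¬full (part e₀ , all))
      ...     | p₀ , ¬P₀ = inj₂ (missing-member-bound (part e₀) p₀ (λ Pe → same Pe Pe₀) ¬P₀)

    located? : ∀ l e → Dec (location (v e) ≡ l)
    located? l e = location (v e) ≟ l

    side-dec : ∀ e σ → Dec (side (v e) ≡ σ)
    side-dec e σ = side (v e) Bool.≟ σ

    -- Each side lies within one part. If one side is empty or both sides share their part, then t
    -- bounds the whole; otherwise the two sides are completely joined and `cyclic-biclique`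
    -- applies.
    pair-bound : ∀ i → i < q → count (located? (suc i)) ≤ t
    pair-bound i i<q with F.any? (λ e → located? (suc i) e ×-dec side-dec e false) | F.any? (λ e → located? (suc i) e ×-dec side-dec e true)
    ... | no ¬left | _ = same-part-bound (located? (suc i)) λ {e} {e′} Pe Pe′ →
      same-class⇒same-part (trans (proj₁ (location-pair i<q (v e) Pe)) (sym (proj₁ (location-pair i<q (v e′) Pe′))))
        (trans (isTrue Pe) (sym (isTrue Pe′)))
      where
      isTrue : ∀ {e} → location (v e) ≡ suc i → side (v e) ≡ true
      isTrue {e} Pe with side (v e) in eq
      ... | true  = refl
      ... | false = contradiction (e , Pe , eq) ¬left
    ... | yes _ | no ¬right = same-part-bound (located? (suc i)) λ {e} {e′} Pe Pe′ →
      same-class⇒same-part (trans (proj₁ (location-pair i<q (v e) Pe)) (sym (proj₁ (location-pair i<q (v e′) Pe′))))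
        (trans (isFalse Pe) (sym (isFalse Pe′)))
      where
      isFalse : ∀ {e} → location (v e) ≡ suc i → side (v e) ≡ false
      isFalse {e} Pe with side (v e) in eq
      ... | false = refl
      ... | true  = contradiction (e , Pe , eq) ¬right
    ... | yes (e₀ , Pe₀ , left) | yes (f₀ , Pf₀ , right) with part e₀ F.≟ part f₀
    ...   | yes eq = same-part-bound (located? (suc i)) λ Pe Pe′ → trans (toLeft Pe) (sym (toLeft Pe′))
      where
      toLeft : ∀ {e} → location (v e) ≡ suc i → part e ≡ part e₀
      toLeft {e} Pe with side (v e) in σ
      ... | false = same-class⇒same-part (trans (proj₁ (location-pair i<q (v e) Pe)) (sym (proj₁ (location-pair i<q (v e₀) Pe₀)))) (trans σ (sym left))
      ... | true  = trans (same-class⇒same-part (trans (proj₁ (location-pair i<q (v e) Pe)) (sym (proj₁ (location-pair i<q (v f₀) Pf₀)))) (trans σ (sym right))) (sym eq)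
    ...   | no neq = cyclic-biclique {{ordinary-nonZero i}} (≤-trans 2L≤n∸b (∸-monoʳ-≤ n (specials≤b i)))
      (located? (suc i)) (side ∘ v) (pos ∘ v) (λ {e} Pe → proj₂ (location-pair i<q (v e) Pe))
      (λ {e} {e′} Pe Pe′ → vertex-injective (trans (grp Pe) (sym (grp Pe′))))
      (λ {e} {f} Pe Pf σ τ → near (v e) (v f) (location-pair i<q (v e) Pe) (location-pair i<q (v f) Pf) σ τ
        (adjacent λ eq → neq (trans (same-class⇒same-part (trans (grp Pe₀) (sym (grp Pe))) (trans left (sym σ)))
          (trans eq (same-class⇒same-part (trans (grp Pf) (sym (grp Pf₀))) (trans τ (sym right)))))))
      (e₀ , Pe₀ , left) (f₀ , Pf₀ , right)
      where
      grp : ∀ {e} → location (v e) ≡ suc i → group (v e) ≡ suc i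
      grp {e} Pe = proj₁ (location-pair i<q (v e) Pe)
      near : ∀ u w → group u ≡ suc i × pos u < ordinary i → group w ≡ suc i × pos w < ordinary i →
             side u ≡ false → side w ≡ true → Adjacent u w → distance i (pos u) (pos w) < L
      near (vertex _ false x) (vertex _ true y) (refl , x<) (refl , y<) refl refl (same , _) = same refl x< y<

    -- Each side lies in one part and so has at most t vertices, with fewer than t unless the part
    -- is contained in it entirely. Two sides that both contain a whole part would give a K_{t,t} in
    -- `B`.
    zero-bound : count (located? 0) ≤ t + L
    zero-bound = begin
      count (located? 0)              ≤⟨ sumFin-mono split ⟩
      sumFin N (λ e → ι (on? false e) + ι (on? true e)) ≡⟨ sumFin-+ N _ _ ⟩
      count (on? false) + count (on? true) ≤⟨ bound (full-or-bound (on? false) same) (full-or-bound (on? true) same) ⟩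
      t + L ∎
      where
      open ≤-Reasoning
      On : Bool → Fin N → Set
      On σ e = location (v e) ≡ 0 × side (v e) ≡ σ
      on? : ∀ σ e → Dec (On σ e)
      on? σ e = located? 0 e ×-dec side-dec e σ
      split : ∀ e → ι (located? 0 e) ≤ ι (on? false e) + ι (on? true e)
      split e = ι-≤ (located? 0 e) λ at0 → bySide at0 (side (v e)) refl
        where
        bySide : location (v e) ≡ 0 → ∀ σ → side (v e) ≡ σ → 1 ≤ ι (on? false e) + ι (on? true e)
        bySide at0 false eq = ≤-trans (≤-reflexive (sym (ι-yes (on? false e) (at0 , eq)))) (m≤m+n _ _)
        bySide at0 true  eq = ≤-trans (≤-reflexive (sym (ι-yes (on? true  e) (at0 , eq)))) (m≤n+m _ _)
      same : ∀ {σ e e′} → On σ e → On σ e′ → part e ≡ part e′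
      same {σ} {e} {e′} (at0 , eq) (at0′ , eq′) =
        same-class⇒same-part (trans (location≡0 (v e) at0) (sym (location≡0 (v e′) at0′))) (trans eq (sym eq′))
      edge : ∀ u w → group u ≡ 0 → group w ≡ 0 → side u ≡ false → side w ≡ true → Adjacent u w → B (pos u) (pos w) ≡ true
      edge (vertex _ false x) (vertex _ true y) refl refl refl refl (adj , _) = adj refl
      member-injective : ∀ {σ a} (full : ∀ p → On σ (member a p)) {p p′} → pos (v (member a p)) ≡ pos (v (member a p′)) → p ≡ p′
      member-injective {σ} {a} full {p} {p′} eq = trans (sym (index-member a p)) (trans (cong index (vertex-injective
          (trans (location≡0 _ (proj₁ (full p))) (sym (location≡0 _ (proj₁ (full p′)))))
          (trans (proj₂ (full p)) (sym (proj₂ (full p′)))) eq)) (index-member a p′))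
      biclique : ∀ {a a′} → (∀ p → On false (member a p)) → (∀ p → On true (member a′ p)) → ⊥
      biclique {a} {a′} full full′ = K-free (λ p → pos (v (member a p))) (λ p → pos (v (member a′ p)))
        (λ p → pos<n _) (λ p → pos<n _) (member-injective full) (member-injective full′)
        λ p p′ → edge (v (member a p)) (v (member a′ p′)) (location≡0 _ (proj₁ (full p))) (location≡0 _ (proj₁ (full′ p′)))
          (proj₂ (full p)) (proj₂ (full′ p′)) (adjacent λ eq → a≢a′ (trans (sym (part-member a p)) (trans eq (part-member a′ p′))))
        where
        a≢a′ : a ≢ a′
        a≢a′ refl = case trans (sym (proj₂ (full F.zero))) (proj₂ (full′ F.zero)) of λ ()
      bound : (∃ λ a → ∀ p → On false (member a p)) ⊎ count (on? false) ≤ L →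
              (∃ λ a → ∀ p → On true (member a p)) ⊎ count (on? true) ≤ L → count (on? false) + count (on? true) ≤ t + L
      bound (inj₁ (a , full)) (inj₁ (a′ , full′)) = ⊥-elim (biclique full full′)
      bound (inj₂ ≤L) _ = ≤-trans (+-mono-≤ ≤L (same-part-bound (on? true) same)) (≤-reflexive (+-comm L t))
      bound (inj₁ _) (inj₂ ≤L) = +-mono-≤ (same-part-bound (on? false) same) ≤L

    single-side : ∀ {j e} → group (v e) ≡ suc (q + j) → side (v e) ≡ false
    single-side {j} {e} g with side (v e) in eq
    ... | false = refl
    ... | true  = contradiction (≤-trans (≤-reflexive (sym g)) (side-true e eq)) (<⇒≱ (s≤s (m≤m+n q j)))

    unpaired-single-bound : ∀ j → q ≤ j → count (located? (suc (q + j))) ≤ t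
    unpaired-single-bound j q≤j = same-part-bound (located? (suc (q + j))) λ {e} {e′} Pe Pe′ →
      same-class⇒same-part (trans (grp Pe) (sym (grp Pe′))) (trans (single-side (grp Pe)) (sym (single-side (grp Pe′))))
      where
      grp : ∀ {e} → location (v e) ≡ suc (q + j) → group (v e) ≡ suc (q + j)
      grp {e} Pe with location-single j (v e) Pe
      ... | inj₁ g = g
      ... | inj₂ (_ , j<q , _) = contradiction j<q (≤⇒≯ q≤j)

    module _ (j : ℕ) (j<q : j < q) where

      X Y : Fin N → Set
      X e = location (v e) ≡ suc j
      Y e = location (v e) ≡ suc (q + j)

      X? : ∀ e → Dec (X e)
      X? = located? (suc j)
      Y? : ∀ e → Dec (Y e)
      Y? = located? (suc (q + j))

      owner′ : Vertex → ℕ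
      owner′ u = owner j (side u) (pos u)

      offset<b : ∀ {e} → IsSpecial j (v e) → pos (v e) ∸ ordinary j < b
      offset<b {e} (_ , _ , ≤x) = <-≤-trans (+-cancelˡ-< (ordinary j) _ _ (begin-strict
        ordinary j + (pos (v e) ∸ ordinary j)  ≡⟨ m+[n∸m]≡n ≤x ⟩
        pos (v e)                              <⟨ pos<n e ⟩
        n                                      ≡⟨ ordinary+specials j ⟨
        ordinary j + specials j                ∎)) (specials≤b j)
        where open ≤-Reasoning

      owner<2b : ∀ {e} → IsSpecial j (v e) → owner′ (v e) < b + b
      owner<2b {e} sp = +-mono-≤-< (sideOffset≤b (side (v e))) (offset<b sp)

      owner-injective : ∀ {e e′} → IsSpecial j (v e) → IsSpecial j (v e′) → owner′ (v e) ≡ owner′ (v e′) → e ≡ e′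
      owner-injective {e} {e′} sp sp′ = cases (side (v e)) (side (v e′)) refl refl
        where
        cases : ∀ σ τ → side (v e) ≡ σ → side (v e′) ≡ τ → owner j σ (pos (v e)) ≡ owner j τ (pos (v e′)) → e ≡ e′
        cases false false σ τ eq = vertex-injective (trans (proj₁ sp) (sym (proj₁ sp′))) (trans σ (sym τ))
          (∸-cancelʳ-≡ (proj₂ (proj₂ sp)) (proj₂ (proj₂ sp′)) eq)
        cases true  true  σ τ eq = vertex-injective (trans (proj₁ sp) (sym (proj₁ sp′))) (trans σ (sym τ))
          (∸-cancelʳ-≡ (proj₂ (proj₂ sp)) (proj₂ (proj₂ sp′)) (+-cancelˡ-≡ b _ _ eq))
        cases false true  σ τ eq = contradiction (offset<b sp)  (≤⇒≯ (≤-trans (m≤m+n b _) (≤-reflexive (sym eq))))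
        cases true  false σ τ eq = contradiction (offset<b sp′) (≤⇒≯ (≤-trans (m≤m+n b _) (≤-reflexive eq)))

      owner-adjacent : ∀ u w → IsSpecial j u → group w ≡ suc (q + j) → Adjacent u w → pos w / L ≡ owner′ u
      owner-adjacent (vertex _ σ x) (vertex _ τ y) (refl , _ , ≤x) refl (_ , out , _) = out j<q refl ≤x

      X-group : ∀ {e} → X e → group (v e) ≡ suc j
      X-group {e} Xe = proj₁ (location-pair j<q (v e) Xe)

      X∩Y-empty : ∀ {e} → X e → ¬ Y e
      X∩Y-empty Xe Ye = contradiction j<q (≤⇒≯ (≤-trans (m≤m+n q j) (≤-reflexive (suc-injective (trans (sym Ye) Xe)))))

      special-bound : (∀ {e} → Y e → IsSpecial j (v e)) → count Y? ≤ t
      special-bound sp = ≤-trans (count-injection-< (b + b) Y? (owner′ ∘ v) (owner<2b ∘ sp) λ Ye Ye′ → owner-injective (sp Ye) (sp Ye′))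
        (m≤n⇒m≤1+n 2b≤L)

      -- x has only L = t - 1 neighbours in the partner class, too few to hold a whole part.
      special-member : ∀ a {x} → IsSpecial j (v x) → part x ≢ a → (∀ p → Y (member a p)) → ∃ λ p → IsSpecial j (v (member a p))
      special-member a {x} sp x∉a full with F.any? (λ p → group (v (member a p)) ≟ suc j)
      ... | yes (p , g) with location-single j (v (member a p)) (full p)
      ...   | inj₁ g′ = contradiction (trans (sym g′) g) λ eq → <⇒≱ j<q (≤-trans (m≤m+n q j) (≤-reflexive (suc-injective eq)))
      ...   | inj₂ sp′ = p , sp′
      special-member a {x} sp x∉a full | no ¬sp = contradiction tooMany 1+n≰n
        where
        single : ∀ p → group (v (member a p)) ≡ suc (q + j)
        single p with location-single j (v (member a p)) (full p)
        ... | inj₁ g = g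
        ... | inj₂ (g , _) = contradiction (p , g) ¬sp
        position : Fin t → ℕ
        position p = pos (v (member a p))
        quotient : ∀ p → position p / L ≡ owner′ (v x)
        quotient p = owner-adjacent (v x) (v (member a p)) sp (single p) (adjacent λ eq → x∉a (trans eq (part-member a p)))
        position-injective : ∀ {p p′} → position p ≡ position p′ → p ≡ p′
        position-injective {p} {p′} eq = trans (sym (index-member a p)) (trans (cong index (vertex-injective
          (trans (single p) (sym (single p′))) (trans (single-side (single p)) (sym (single-side (single p′)))) eq)) (index-member a p′))
        tooMany : t ≤ L
        tooMany = F.injective⇒≤ {f = λ p → fromℕ< (m%n<n (position p) L)} λ {p} {p′} eq → position-injective (begin
          position p                                     ≡⟨ m≡m%n+[m/n]*n (position p) L ⟩
          position p % L + position p / L * L            ≡⟨ cong₂ (λ a b → a + b * L) (F.fromℕ<-injective _ _ (m%n<n (position p) L) (m%n<n (position p′) L) eq)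
                                                                  (trans (quotient p) (sym (quotient p′))) ⟩
          position p′ % L + position p′ / L * L          ≡⟨ m≡m%n+[m/n]*n (position p′) L ⟨
          position p′                                    ∎)
          where open ≡-Reasoning

      -- The intervals of distinct owners are disjoint, so v₀ leaves room for a single member x of Y outside its part.
      -- If Y contains the whole part of v₀, then Y has t + 1 members, but then X lies in the part of x.
      module _ {v₀ x : Fin N} (v₀-single : group (v v₀) ≡ suc (q + j)) (Yx : Y x) (x∉ : part x ≢ part v₀) where

        Y-special : ∀ {e} → Y e → part e ≢ part v₀ → IsSpecial j (v e)
        Y-special {e} Ye e∉ with location-single j (v e) Ye
        ... | inj₂ sp = sp
        ... | inj₁ g  = contradiction (same-class⇒same-part (trans g (sym v₀-single))
                          (trans (single-side g) (sym (single-side v₀-single)))) e∉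

        Y-unique : ∀ {e} → Y e → part e ≢ part v₀ → e ≡ x
        Y-unique {e} Ye e∉ = owner-injective (Y-special Ye e∉) (Y-special Yx x∉)
          (trans (sym (owner-adjacent (v e) (v v₀) (Y-special Ye e∉) v₀-single (adjacent e∉)))
                 (owner-adjacent (v x) (v v₀) (Y-special Yx x∉) v₀-single (adjacent x∉)))

        module _ (c : ℕ) where

          label′ : ∀ {e} → Dec (part e ≡ part v₀) → ℕ
          label′ {e} (yes _) = toℕ (index e)
          label′     (no _)  = c

          label : Fin N → ℕ
          label e = label′ (part e F.≟ part v₀)

          label-bound : ∀ m → t ≤ m → c < m → (∀ {e} → Y e → part e ≡ part v₀ → toℕ (index e) ≢ c) → count Y? ≤ m
          label-bound m t≤m c<m avoid = count-injection-< m Y? label label<m label-injective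
            where
            label<m : ∀ {e} → Y e → label e < m
            label<m {e} _ with part e F.≟ part v₀
            ... | yes _ = <-≤-trans (toℕ<n (index e)) t≤m
            ... | no _  = c<m
            label-injective : ∀ {e e′} → Y e → Y e′ → label e ≡ label e′ → e ≡ e′
            label-injective {e} {e′} Ye Ye′ eq with part e F.≟ part v₀ | part e′ F.≟ part v₀
            ... | yes a | yes a′ = part-index-injective (trans a (sym a′)) (toℕ-injective eq)
            ... | yes a | no  _  = contradiction eq (avoid Ye a)
            ... | no  _ | yes a′ = contradiction (sym eq) (avoid Ye′ a′)
            ... | no  a | no  a′ = trans (Y-unique Ye a) (sym (Y-unique Ye′ a′))

        -- The part of `v₀` has a special member `u` in the same two-class group as `x`; lying in
        -- different parts, `u` and `x` are on opposite sides. A vertex of `X` outside the part of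
        -- `x` is also outside that of `v₀`, which `Y` contains; adjacent to both `u` and `x`, it
        -- would need a third side.
        X-part : (∀ p → Y (member (part v₀) p)) → ∀ {e} → X e → part e ≡ part x
        X-part full {e} Xe with special-member (part v₀) (Y-special Yx x∉) x∉ full | part e F.≟ part x
        ... | p , sp | yes eq = eq
        ... | p , sp | no neq = ⊥-elim (noThree _ _ _
                (Adjacent-side (adjacent e≁u) (trans (X-group Xe) (sym (proj₁ sp))))
                (Adjacent-side (adjacent neq) (trans (X-group Xe) (sym (proj₁ (Y-special Yx x∉)))))
                (Adjacent-side (adjacent x≁u) (trans (proj₁ (Y-special Yx x∉)) (sym (proj₁ sp)))))
          where
          u : Fin N
          u = member (part v₀) p
          x≁u : part x ≢ part u
          x≁u eq = x∉ (trans eq (part-member (part v₀) p))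
          e≁u : part e ≢ part u
          e≁u eq = X∩Y-empty Xe (subst Y (part-index-injective
            (trans (part-member _ _) (sym (trans eq (part-member _ p)))) (index-member _ _)) (full (index e)))
          noThree : ∀ (σ τ υ : Bool) → σ ≢ τ → σ ≢ υ → υ ≢ τ → ⊥
          noThree false false _     a _ _ = a refl
          noThree true  true  _     a _ _ = a refl
          noThree false true  false _ b _ = b refl
          noThree true  false true  _ b _ = b refl
          noThree false true  true  _ _ c = c refl
          noThree true  false false _ _ c = c refl

        -- If `Y` contains the part of `v₀`, its possible surplus vertex is paid for by `X`: that
        -- lies in the part of `x` but misses `x` itself, leaving at most L. Otherwise the index of
        -- a missing member is free as a label for `x`.
        mixed-bound : count X? + count Y? ≤ t + t
        mixed-bound with F.all? (λ p → Y? (member (part v₀) p))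
        ... | yes full = begin
          count X? + count Y?   ≤⟨ +-mono-≤ (missing-member-bound X? (part x) (index x) (X-part full)
                                      (λ Xx → X∩Y-empty (subst X (part-index-injective (part-member _ _) (index-member _ _)) Xx) Yx))
                                    (label-bound t (suc t) (n≤1+n t) ≤-refl λ {e} _ _ → <⇒≢ (toℕ<n (index e))) ⟩
          L + suc t             ≡⟨ +-suc L t ⟩
          t + t                 ∎
          where open ≤-Reasoning
        ... | no ¬full with F.¬∀⟶∃¬ t (λ p → Y (member (part v₀) p)) (λ p → Y? (member (part v₀) p)) ¬full
        ...   | p₀ , ¬Y₀ = +-mono-≤ (pair-bound j j<q) (label-bound (toℕ p₀) t ≤-refl (toℕ<n p₀) λ {e} Ye a eq →
                  ¬Y₀ (subst Y (part-index-injective (trans a (sym (part-member _ _))) (trans (toℕ-injective eq) (sym (index-member _ _)))) Ye))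

      -- Either `Y` consists of special vertices only, or it contains a vertex `v₀` of the one-class
      -- group; then a member outside the part of `v₀` is the sole case where `Y` may exceed t.
      paired-bound : count X? + count Y? ≤ t + t
      paired-bound with F.any? (λ e → Y? e ×-dec (group (v e) ≟ suc (q + j)))
      ... | no ¬single = +-mono-≤ (pair-bound j j<q) (special-bound sp)
        where
        sp : ∀ {e} → Y e → IsSpecial j (v e)
        sp {e} Ye with location-single j (v e) Ye
        ... | inj₁ g  = contradiction (e , Ye , g) ¬single
        ... | inj₂ sp = sp
      ... | yes (v₀ , _ , g) with F.any? (λ e → Y? e ×-dec ¬? (part e F.≟ part v₀))
      ...   | yes (x , Yx , x∉) = mixed-bound g Yx x∉
      ...   | no ¬x = +-mono-≤ (pair-bound j j<q) (same-part-bound Y? λ Ye Ye′ → trans (samePart Ye) (sym (samePart Ye′)))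
        where
        samePart : ∀ {e} → Y e → part e ≡ part v₀
        samePart {e} Ye with part e F.≟ part v₀
        ... | yes eq = eq
        ... | no neq = contradiction (e , Ye , neq) ¬x

    too-small : N < suc r * t
    too-small = begin-strict
      N                                                   ≡⟨ trans (sumFin-const N 1) (*-identityʳ N) ⟨
      sumFin N (λ _ → 1)                                  ≤⟨ sumFin-mono (λ e → ≤-trans (≤-reflexive (sym (ι-yes (located? (location (v e)) e) refl)))
                                                               (term≤∑ r (λ l → ι (located? l e)) (location<r (v e) (group<r e) (pos<n e)))) ⟩
      sumFin N (λ e → ∑ r (λ l → ι (located? l e)))       ≡⟨ sumFin-swap N r (λ e l → ι (located? (toℕ l) e)) ⟩
      ∑ r (λ l → count (located? l))                      ≡⟨ cong (count (located? 0) +_) (∑-split q s (λ l → count (located? (suc l)))) ⟩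
      count (located? 0) + (∑ q (λ i → count (located? (suc i))) + ∑ s (λ j → count (located? (suc (q + j)))))
                                                          ≤⟨ +-mono-≤ zero-bound (∑-paired-bound q s t _ _ (λ i i<q _ → paired-bound i i<q)
                                                               (λ i i<q _ → pair-bound i i<q) (λ j _ q≤j → unpaired-single-bound j q≤j)) ⟩
      t + L + (q + s) * t                                 <⟨ +-monoˡ-< ((q + s) * t) (+-monoʳ-< t ≤-refl) ⟩
      t + t + (q + s) * t                                 ≡⟨ +-assoc t t _ ⟩
      suc r * t                                           ∎
      where open ≤-Reasoning

-- Sums over pairs of classes

record SummandOf {k : ℕ} (N : ℕ) : Set where
  field
    summand : Fin k → Fin k → ℕ
    expand  : N ≡ sumFin k λ i → sumFin k λ j → summand i j
open SummandOf

-- The summands of edges and turanNumber mention local functions of Defs and are therefore captured by unification.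
edgeSummand : ∀ {k n} (G : KPartiteGraph k n) → SummandOf {k} (edges G)
edgeSummand G = record { summand = _ ; expand = refl }

edgeSummand-< : ∀ {k n} (G : KPartiteGraph k n) i j → toℕ i < toℕ j →
  summand (edgeSummand G) i j ≡ sumFin n λ x → sumFin n λ y → ⟦ adj G i x j y ⟧
edgeSummand-< G i j i<j with toℕ i <? toℕ j
... | yes _  = refl
... | no i≮j = contradiction i<j i≮j

turanSummand : ∀ r k → .{{_ : NonZero r}} → SummandOf {k} (turanNumber r k)
turanSummand r k = record { summand = _ ; expand = refl }

turanSummand≤1 : ∀ r k → .{{_ : NonZero r}} → ∀ i j → summand (turanSummand r k) i j ≤ 1
turanSummand≤1 r k i j with toℕ i <? toℕ j | (toℕ i % r) ≟ (toℕ j % r)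
... | yes _ | no  _ = s≤s z≤n
... | yes _ | yes _ = z≤n
... | no  _ | no  _ = z≤n
... | no  _ | yes _ = z≤n

turanSummand≡0 : ∀ r k → .{{_ : NonZero r}} → ∀ i j → (toℕ i < toℕ j → toℕ i % r ≡ toℕ j % r) →
  summand (turanSummand r k) i j ≡ 0
turanSummand≡0 r k i j same with toℕ i <? toℕ j | (toℕ i % r) ≟ (toℕ j % r)
... | yes i<j | no neq = contradiction (same i<j) neq
... | yes _   | yes _  = refl
... | no  _   | no  _  = refl
... | no  _   | yes _  = refl

sumFin² : ∀ {k} → (Fin k → Fin k → ℕ) → ℕ
sumFin² {k} f = sumFin k λ i → sumFin k λ j → f i j

sumFin²-+ : ∀ {k} (f g : Fin k → Fin k → ℕ) → sumFin² (λ i j → f i j + g i j) ≡ sumFin² f + sumFin² g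
sumFin²-+ {k} f g = trans (sumFin-cong λ i → sumFin-+ k (f i) (g i))
  (sumFin-+ k (λ i → sumFin k (f i)) (λ i → sumFin k (g i)))

sumFin²-* : ∀ {k} (f : Fin k → Fin k → ℕ) c → sumFin² (λ i j → f i j * c) ≡ sumFin² f * c
sumFin²-* {k} f c = trans (sumFin-cong λ i → sumFin-* k (f i) c) (sumFin-* k (λ i → sumFin k (f i)) c)

∑-indicator-lower : ∀ {μ n} → μ ≤ n → μ ≤ ∑ n (λ i → ι (i <? μ))
∑-indicator-lower {μ} μ≤n = count-lower (λ i → i <? μ) (λ i → i) (λ i<μ → <-≤-trans i<μ μ≤n , i<μ) (λ _ _ eq → eq)

∑-indicator-upper : ∀ μ n → ∑ n (λ i → ι (i <? μ)) ≤ μ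
∑-indicator-upper μ n = count-injection-< μ {P = λ (i : Fin n) → toℕ i < μ} (λ i → toℕ i <? μ) toℕ (λ i<μ → i<μ) (λ _ _ → toℕ-injective)

∑-delta-upper : ∀ n a c → ∑ n (λ x → ι (x ≟ a) * c) ≤ c
∑-delta-upper n a c = begin
  ∑ n (λ x → ι (x ≟ a) * c)  ≡⟨ sumFin-* n _ c ⟩
  ∑ n (λ x → ι (x ≟ a)) * c  ≤⟨ *-monoˡ-≤ c (count-subsingleton {P = λ (i : Fin n) → toℕ i ≡ a} (λ i → toℕ i ≟ a) (yes tt)
                                  (λ eq eq′ → toℕ-injective (trans eq (sym eq′))) (λ _ → tt)) ⟩
  1 * c                      ≡⟨ *-identityˡ c ⟩
  c                          ∎
  where open ≤-Reasoning

-- The edges inside a group with special vertices, compared with L n. The surplus consists of one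
-- loss b (n - L) for each of its two classes, which cancels against the edges missing to the
-- partner, and of the net gain b (L - b).
pair-identity : ∀ b {L n l e} → L ≡ b + l → n ≡ L + e →
  (n ∸ b) * (L + b) + b * n ≡ L * n + (b * (n ∸ L) + b * (n ∸ L) + b * (L ∸ b))
pair-identity b {l = l} {e} refl refl
  rewrite m+n∸m≡n (b + l) e | m+n∸m≡n b l | trans (cong (_∸ b) (+-assoc b l e)) (m+n∸m≡n b (l + e)) =
  solve 3 (λ b l e → (l :+ e) :* (b :+ l :+ b) :+ b :* (b :+ l :+ e)
    := (b :+ l) :* (b :+ l :+ e) :+ (b :* e :+ b :* e :+ b :* l)) refl b l e
  where open +-*-Solver

-- Counting the edges

module EdgeCount (L q s n b z : ℕ) .{{L≢0 : NonZero L}} (b<n : b < n) (B : ℕ → ℕ → Bool)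
  (b≤L : b ≤ L) (L≤n∸b : L ≤ n ∸ b) (2bL≤n : (b + b) * L ≤ n) (z≤B : z ≤ ∑ n (λ x → ∑ n (λ y → ⟦ B x y ⟧)))
  where

  open Construction L q s n b b<n B
  open ≤-Reasoning

  IsPartner : ℕ → ℕ → Set
  IsPartner zero    h = ⊥
  IsPartner (suc i) h = i < q × h ≡ suc (q + i)

  partner? : ∀ g h → Dec (IsPartner g h)
  partner? zero    h = no λ ()
  partner? (suc i) h = (i <? q) ×-dec (h ≟ suc (q + i))

  not-partner⇒across : ∀ g σ x h y → ¬ IsPartner g h → Across g σ x h y
  not-partner⇒across zero    σ x h y _  = tt
  not-partner⇒across (suc i) σ x h y ¬p i<q eq _ = contradiction (i<q , eq) ¬p

  partner-asym : ∀ g h → IsPartner g h → ¬ IsPartner h g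
  partner-asym (suc i) .(suc (q + i)) (i<q , refl) (q+i<q , _) = m+n≮m q i q+i<q

  partner-irrefl : ∀ g → ¬ IsPartner g g
  partner-irrefl g p = partner-asym g g p p

  partner⇒≢ : ∀ {g h} → IsPartner g h → g ≢ h
  partner⇒≢ p refl = partner-irrefl _ p

  between : ℕ → Bool → ℕ → Bool → ℕ
  between g σ h τ = ∑ n (λ x → ∑ n (λ y → ι (adjacent? (vertex g σ x) (vertex h τ y))))

  between-sym : ∀ g σ h τ → between g σ h τ ≡ between h τ g σ
  between-sym g σ h τ = trans
    (sumFin-swap n n (λ x y → ι (adjacent? (vertex g σ (toℕ x)) (vertex h τ (toℕ y)))))
    (∑-cong n λ y _ → ∑-cong n λ x _ → cong ⟦_⟧ (does-⇔ (mk⇔ Adjacent-sym Adjacent-sym)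
      (adjacent? (vertex g σ x) (vertex h τ y)) (adjacent? (vertex h τ y) (vertex g σ x))))

  row-full : ∀ u h τ → (∀ y → Adjacent u (vertex h τ y)) → n ≤ ∑ n (λ y → ι (adjacent? u (vertex h τ y)))
  row-full u h τ all = ≤-trans (≤-reflexive (sym (*-identityʳ n)))
    (∑-lower n 1 λ y _ → ≤-reflexive (sym (ι-yes (adjacent? u (vertex h τ y)) (all y))))

  ∑-special : ∀ i (f : ℕ → ℕ) {c d} → (∀ x → x < ordinary i → c ≤ f x) →
    (∀ τ → τ < specials i → d ≤ f (ordinary i + τ)) → ordinary i * c + specials i * d ≤ ∑ n f
  ∑-special i f {c} {d} c≤ d≤ = begin
    ordinary i * c + specials i * d  ≤⟨ +-mono-≤ (∑-lower (ordinary i) c c≤) (∑-lower (specials i) d d≤) ⟩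
    ∑ (ordinary i) f + ∑ (specials i) (λ x → f (ordinary i + x))  ≡⟨ ∑-split (ordinary i) (specials i) f ⟨
    ∑ (ordinary i + specials i) f    ≡⟨ cong (λ m → ∑ m f) (ordinary+specials i) ⟩
    ∑ n f                            ∎

  between-full : ∀ g σ h τ → g ≢ h → ¬ IsPartner g h → ¬ IsPartner h g → n * n ≤ between g σ h τ
  between-full g σ h τ g≢h ¬p ¬p′ = ∑-lower n n λ x _ → row-full (vertex g σ x) h τ λ y →
    (λ eq → contradiction eq g≢h) , not-partner⇒across g σ x h y ¬p , not-partner⇒across h τ y g x ¬p′

  between-zero : z ≤ between 0 false 0 true
  between-zero = ≤-trans z≤B (∑-mono n λ x _ → ∑-mono n λ y _ → edge x y)
    where
    edge : ∀ x y → ⟦ B x y ⟧ ≤ ι (adjacent? (vertex 0 false x) (vertex 0 true y))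
    edge x y with B x y in eq
    ... | false = z≤n
    ... | true  = ≤-refl

  L≤n : L ≤ n
  L≤n = ≤-trans L≤n∸b (m∸n≤m n b)

  loss gain : ℕ
  loss = b * (n ∸ L)
  gain = b * (L ∸ b)

  specials≡b : ∀ {i} → i < s → specials i ≡ b
  specials≡b {i} i<s = cong (if_then b else 0) (dec-true (i <? s) i<s)

  owner-row : ∀ {c} → c < b + b → L ≤ ∑ n (λ y → ι (y / L ≟ c))
  owner-row {c} c<2b = count-lower (λ y → y / L ≟ c) (λ d → d + c * L)
    (λ {d} d<L → <-≤-trans (+-monoˡ-< (c * L) d<L) (≤-trans (*-monoˡ-≤ L c<2b) 2bL≤n) , quotient d<L)
    (λ _ _ → +-cancelʳ-≡ (c * L) _ _)
    where
    quotient : ∀ {d} → d < L → (d + c * L) / L ≡ c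
    quotient {d} d<L = begin-equality
      (d + c * L) / L      ≡⟨ +-distrib-/-∣ʳ d (divides-refl c) ⟩
      d / L + c * L / L    ≡⟨ cong₂ _+_ (m<n⇒m/n≡0 d<L) (m*n/n≡m c L) ⟩
      c                    ∎

  between-partner : ∀ {i} → i < q → i < s → ∀ σ τ → n * n ≤ between (suc i) σ (suc (q + i)) τ + loss
  between-partner {i} i<q i<s σ τ = begin
    n * n                                        ≡⟨ cong (_* n) (ordinary+specials i) ⟨
    (ordinary i + specials i) * n                ≡⟨ *-distribʳ-+ n (ordinary i) (specials i) ⟩
    ordinary i * n + specials i * n              ≡⟨ cong (λ m → ordinary i * n + specials i * m) (m+[n∸m]≡n L≤n) ⟨
    ordinary i * n + specials i * (L + (n ∸ L))  ≡⟨ cong (ordinary i * n +_) (*-distribˡ-+ (specials i) L (n ∸ L)) ⟩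
    ordinary i * n + (specials i * L + specials i * (n ∸ L)) ≡⟨ +-assoc (ordinary i * n) _ _ ⟨
    ordinary i * n + specials i * L + specials i * (n ∸ L)   ≡⟨ cong (λ m → ordinary i * n + specials i * L + m * (n ∸ L)) (specials≡b i<s) ⟩
    ordinary i * n + specials i * L + loss       ≤⟨ +-monoˡ-≤ loss (∑-special i _ ordinary-row special-row) ⟩
    between (suc i) σ (suc (q + i)) τ + loss     ∎
    where
    isPartner : IsPartner (suc i) (suc (q + i))
    isPartner = i<q , refl
    adjacent : ∀ {x y} → (ordinary i ≤ x → y / L ≡ owner i σ x) → Adjacent (vertex (suc i) σ x) (vertex (suc (q + i)) τ y)
    adjacent {x} {y} across = (λ eq → contradiction eq (partner⇒≢ isPartner)) , (λ _ _ → across)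
      , not-partner⇒across (suc (q + i)) τ y (suc i) x (partner-asym (suc i) (suc (q + i)) isPartner)
    ordinary-row : ∀ x → x < ordinary i → n ≤ ∑ n (λ y → ι (adjacent? (vertex (suc i) σ x) (vertex (suc (q + i)) τ y)))
    ordinary-row x x< = row-full (vertex (suc i) σ x) (suc (q + i)) τ λ y → adjacent λ ≤x → contradiction ≤x (<⇒≱ x<)
    special-row : ∀ c → c < specials i → L ≤ ∑ n (λ y → ι (adjacent? (vertex (suc i) σ (ordinary i + c)) (vertex (suc (q + i)) τ y)))
    special-row c c< = ≤-trans (owner-row owner<2b) (∑-mono n λ y _ →
      ι-mono (y / L ≟ owner i σ (ordinary i + c)) (adjacent? (vertex (suc i) σ (ordinary i + c)) (vertex (suc (q + i)) τ y)) λ eq → adjacent λ _ → eq)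
      where
      owner<2b : owner i σ (ordinary i + c) < b + b
      owner<2b = +-mono-≤-< (sideOffset≤b σ) (≤-trans (≤-reflexive (cong suc (m+n∸m≡n (ordinary i) c))) (≤-trans c< (specials≤b i)))

  -- A special vertex on the left sees the whole right class; an ordinary one sees its L cyclic
  -- neighbours and all special vertices on the right.
  between-pair-specials : ∀ {i} → i < q →
    ordinary i * (L + specials i) + specials i * n ≤ between (suc i) false (suc i) true
  between-pair-specials {i} i<q = ∑-special i _ ordinary-row
    λ c _ → row-full (vertex (suc i) false (ordinary i + c)) (suc i) true λ y → adjacent λ x< → contradiction (m≤m+n (ordinary i) c) (<⇒≱ x<)
    where
    adjacent : ∀ {x y} → Within (suc i) x y → Adjacent (vertex (suc i) false x) (vertex (suc i) true y)
    adjacent {x} {y} w = (λ _ → w) , not-partner⇒across (suc i) false x (suc i) y (partner-irrefl (suc i))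
      , not-partner⇒across (suc i) true y (suc i) x (partner-irrefl (suc i))
    ordinary-row : ∀ x → x < ordinary i → L + specials i ≤ ∑ n (λ y → ι (adjacent? (vertex (suc i) false x) (vertex (suc i) true y)))
    ordinary-row x x< = begin
      L + specials i                                 ≤⟨ +-mono-≤ near far ⟩
      ∑ (ordinary i) f + ∑ (specials i) (λ y → f (ordinary i + y)) ≡⟨ ∑-split (ordinary i) (specials i) f ⟨
      ∑ (ordinary i + specials i) f                  ≡⟨ cong (λ m → ∑ m f) (ordinary+specials i) ⟩
      ∑ n f                                          ∎
      where
      f : ℕ → ℕ
      f y = ι (adjacent? (vertex (suc i) false x) (vertex (suc i) true y))
      near : L ≤ ∑ (ordinary i) f
      near = ≤-trans (disp-row (ordinary i) {{ordinary-nonZero i}} (≤-trans L≤n∸b (∸-monoʳ-≤ n (specials≤b i))) x<)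
        (∑-mono (ordinary i) λ y _ → ι-mono (distance i x y <? L) (adjacent? (vertex (suc i) false x) (vertex (suc i) true y)) λ d< → adjacent λ _ _ → d<)
      far : specials i ≤ ∑ (specials i) (λ y → f (ordinary i + y))
      far = ≤-trans (≤-reflexive (sym (*-identityʳ (specials i)))) (∑-lower (specials i) 1 λ y _ → ≤-reflexive
        (sym (ι-yes (adjacent? (vertex (suc i) false x) (vertex (suc i) true (ordinary i + y))) (adjacent λ _ y< → contradiction (m≤m+n (ordinary i) y) (<⇒≱ y<)))))

  between-pair : ∀ {i} → i < q → L * n + ι (i <? s) * (loss + loss + gain) ≤ between (suc i) false (suc i) true
  between-pair {i} i<q = ≤-trans (≤-reflexive (sym (total (i <? s)))) (between-pair-specials i<q)
    where
    without-specials : ∀ {p} → p ≡ 0 → (n ∸ p) * (L + p) + p * n ≡ L * n + 0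
    without-specials refl = cong (_+ 0) (trans (*-comm n (L + 0)) (cong (_* n) (+-identityʳ L)))
    total : (i<?s : Dec (i < s)) → ordinary i * (L + specials i) + specials i * n ≡ L * n + ι i<?s * (loss + loss + gain)
    total (no i≮s) = without-specials (cong (if_then b else 0) (dec-false (i <? s) i≮s))
    total (yes i<s) rewrite specials≡b i<s = begin-equality
      (n ∸ b) * (L + b) + b * n               ≡⟨ pair-identity b (sym (m+[n∸m]≡n b≤L)) (sym (m+[n∸m]≡n L≤n)) ⟩
      L * n + (loss + loss + gain)            ≡⟨ cong (L * n +_) (*-identityˡ _) ⟨
      L * n + 1 * (loss + loss + gain)        ∎

  weight : ℕ → ℕ → ℕ
  weight a c = between (a % r) (does (r ≤? a)) (c % r) (does (r ≤? c))

  μ : ℕ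
  μ = q ⊓ s

  inner : ℕ → ℕ
  inner zero    = z
  inner (suc i) = L * n + ι (i <? s) * (loss + loss + gain)

  -- The cutoff `μ` bounds the sum over any range by `μ * loss`. The value 0 at 0 also covers the
  -- truncated arguments `a ∸ q` with a ≤ q in `backwardLoss`.
  lossAt : ℕ → ℕ
  lossAt zero    = 0
  lossAt (suc i) = ι (i <? μ) * loss

  lossAt≡loss : ∀ {i} → i < q → i < s → lossAt (suc i) ≡ loss
  lossAt≡loss {i} i<q i<s = trans (cong (_* loss) (ι-yes (i <? μ) (⊓-pres-m< i<q i<s))) (*-identityˡ loss)

  weight-inner : ∀ a → a ≤ q → inner a ≤ weight a (a + r)
  weight-inner a a≤q with classView a (s≤s (≤-trans a≤q (m≤m+n q r))) | classView (a + r) (+-monoˡ-≤ r (s≤s a≤q))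
  ... | second g _ eq _ _ | _ = contradiction (≤-trans (s≤s (≤-trans a≤q (m≤m+n q s))) (≤-trans (m≤n+m r g) (≤-reflexive (sym eq)))) 1+n≰n
  ... | _ | first a+r<r _ _ = contradiction a+r<r (m+n≮n a r)
  ... | first _ e σ | second g _ eq e′ τ with refl ← +-cancelʳ-≡ r a g eq rewrite e | σ | e′ | τ = inner≤ a a≤q
    where
    inner≤ : ∀ a → a ≤ q → inner a ≤ between a false a true
    inner≤ zero    _   = between-zero
    inner≤ (suc i) i<q = between-pair i<q

  second≮r : ∀ {a} g → a ≡ g + r → ¬ a < r
  second≮r g refl = m+n≮n g r

  groups-differ : ∀ {a c} → a < c → c ≢ a + r → ClassView a → ClassView c → a % r ≢ c % r
  groups-differ a<c c≢a+r (first _ e _) (first _ e′ _) eq = <⇒≢ a<c (trans (sym e) (trans eq e′))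
  groups-differ a<c c≢a+r (first _ e _) (second g _ c≡ e′ _) eq = c≢a+r (trans c≡ (cong (_+ r) (trans (sym e′) (trans (sym eq) e))))
  groups-differ a<c c≢a+r (second g _ a≡ _ _) (first c<r _ _) _ = second≮r g a≡ (<-trans a<c c<r)
  groups-differ a<c c≢a+r (second g _ a≡ e _) (second g′ _ c≡ e′ _) eq =
    <⇒≢ a<c (trans a≡ (trans (cong (_+ r) (trans (sym e) (trans eq e′))) (sym c≡)))

  partner≰q : ∀ {g h} → IsPartner g h → ¬ h ≤ q
  partner≰q {suc i} (_ , refl) = <⇒≱ (s≤s (m≤m+n q i))

  between-partners : ∀ g h σ τ → IsPartner g h → h < r → n * n ≤ between g σ h τ + loss
  between-partners (suc i) h σ τ (i<q , refl) h<r = between-partner i<q (+-cancelˡ-< q i s (≤-pred h<r)) σ τ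

  partner-forward : ∀ {a c} → a < c → ClassView a → ClassView c → IsPartner (a % r) (c % r) → c ≡ a + q × lossAt a ≡ loss
  partner-forward {a} a<c (first _ e _) (first c<r e′ _) p = go a c<r (subst₂ IsPartner e e′ p)
    where
    go : ∀ a {c} → c < r → IsPartner a c → c ≡ a + q × lossAt a ≡ loss
    go (suc i) c<r (i<q , refl) = cong suc (+-comm q i) , lossAt≡loss i<q (+-cancelˡ-< q i s (≤-pred c<r))
  partner-forward a<c (second g _ a≡ _ _) (first c<r _ _) p = contradiction (<-trans a<c c<r) (second≮r g a≡)
  partner-forward a<c _ (second g g≤q _ e _) p = contradiction (≤-trans (≤-reflexive e) g≤q) (partner≰q p)

  partner-backward : ∀ {a c} → a < c → ClassView a → ClassView c → IsPartner (c % r) (a % r) → c ≡ a + suc s × lossAt (a ∸ q) ≡ loss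
  partner-backward a<c (second g g≤q _ e _) _ p = contradiction (≤-trans (≤-reflexive e) g≤q) (partner≰q p)
  partner-backward {a} {c} a<c (first _ e _) (first _ e′ _) p = contradiction a<c (<⇒≯ (go c (subst₂ IsPartner e′ e p)))
    where
    go : ∀ c {a} → IsPartner c a → c < a
    go (suc i) {a} (i<q , refl) = s≤s (≤-trans i<q (m≤m+n q i))
  partner-backward {a} a<c (first a<r e _) (second g _ c≡ e′ _) p = go g a<r c≡ (subst₂ IsPartner e′ e p)
    where
    go : ∀ g {a c} → a < r → c ≡ g + r → IsPartner g a → c ≡ a + suc s × lossAt (a ∸ q) ≡ loss
    go (suc i) a<r refl (i<q , refl) =
      solve 3 (λ i q s → con 1 :+ i :+ (con 1 :+ (q :+ s)) := con 1 :+ (q :+ i) :+ (con 1 :+ s)) refl i q s ,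
      trans (cong lossAt (trans (cong (_∸ q) (sym (+-suc q i))) (m+n∸m≡n q (suc i)))) (lossAt≡loss i<q (+-cancelˡ-< q i s (≤-pred a<r)))
      where open +-*-Solver

  delta-loss : ∀ {x y l} → x ≡ y × l ≡ loss → loss ≤ ι (x ≟ y) * l
  delta-loss {x} {y} (eq , refl) = ≤-reflexive (sym (trans (cong (_* loss) (ι-yes (x ≟ y) eq)) (*-identityˡ loss)))

  -- The classes of group 1 + i are numbered 1 + i and 1 + i + r, with the partner 1 + q + i between
  -- them. It lies `q` above the former and r - q = s + 1 below the latter; the offsets `q` and
  -- `suc s` record this.
  forwardLoss backwardLoss : ℕ → ℕ → ℕ
  forwardLoss  a c = ι (c ≟ a + q) * lossAt a
  backwardLoss a c = ι (c ≟ a + suc s) * lossAt (a ∸ q)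

  -- Each partnership occurs twice, a two-class group having one pair of classes on either side of its partner.
  weight-outer : ∀ {a c} → a < c → c < k → c ≢ a + r →
    n * n ≤ weight a c + (forwardLoss a c + backwardLoss a c)
  weight-outer {a} {c} a<c c<k c≢a+r with partner? (a % r) (c % r) | partner? (c % r) (a % r)
  ... | no ¬p | no ¬p′ = ≤-trans (between-full (a % r) _ (c % r) _
    (groups-differ a<c c≢a+r (classView a (<-trans a<c c<k)) (classView c c<k)) ¬p ¬p′) (m≤m+n _ _)
  ... | yes p | _ = ≤-trans (between-partners (a % r) (c % r) _ _ p (m%n<n c r))
    (+-monoʳ-≤ (weight a c) (≤-trans (delta-loss (partner-forward a<c (classView a (<-trans a<c c<k)) (classView c c<k) p)) (m≤m+n _ _)))
  ... | no _ | yes p = ≤-trans (≤-trans (between-partners (c % r) (a % r) _ _ p (m%n<n a r))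
      (≤-reflexive (cong (_+ loss) (between-sym (c % r) _ (a % r) _))))
    (+-monoʳ-≤ (weight a c) (≤-trans (delta-loss (partner-backward a<c (classView a (<-trans a<c c<k)) (classView c c<k) p)) (m≤n+m _ _)))

  innerAt : ℕ → ℕ → ℕ
  innerAt a c = ι (c ≟ a + r) * inner a

  -- Two classes of one group contribute `inner` and nothing to the Turán number; classes of
  -- different groups contribute n², up to losses, which stand on the right to avoid subtraction.
  pointwise : ∀ i j → summand (turanSummand r k) i j * (n * n) + innerAt (toℕ i) (toℕ j) ≤
    summand (edgeSummand graph) i j + (forwardLoss (toℕ i) (toℕ j) + backwardLoss (toℕ i) (toℕ j))
  pointwise i j = cases (toℕ i <? toℕ j) (toℕ j ≟ toℕ i + r)
    where
    T S : ℕ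
    T = summand (turanSummand r k) i j
    S = summand (edgeSummand graph) i j
    F : ℕ
    F = forwardLoss (toℕ i) (toℕ j) + backwardLoss (toℕ i) (toℕ j)
    T≡0 : (toℕ i < toℕ j → toℕ i % r ≡ toℕ j % r) → T * (n * n) ≡ 0
    T≡0 same = cong (_* (n * n)) (turanSummand≡0 r k i j same)
    innerAt≡0 : toℕ j ≢ toℕ i + r → innerAt (toℕ i) (toℕ j) ≡ 0
    innerAt≡0 j≢ = cong (_* inner (toℕ i)) (ι-no (toℕ j ≟ toℕ i + r) j≢)
    cases : Dec (toℕ i < toℕ j) → Dec (toℕ j ≡ toℕ i + r) → T * (n * n) + innerAt (toℕ i) (toℕ j) ≤ S + F
    cases (no i≮j) (yes j≡) = contradiction (≤-trans (m<m+n (toℕ i) z<s) (≤-reflexive (sym j≡))) i≮j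
    cases (no i≮j) (no j≢) = ≤-trans (≤-reflexive (cong₂ _+_ (T≡0 λ i<j → contradiction i<j i≮j) (innerAt≡0 j≢))) z≤n
    cases (yes i<j) (no j≢) = begin
      T * (n * n) + innerAt (toℕ i) (toℕ j)  ≡⟨ trans (cong (T * (n * n) +_) (innerAt≡0 j≢)) (+-identityʳ _) ⟩
      T * (n * n)                            ≤⟨ *-monoˡ-≤ (n * n) (turanSummand≤1 r k i j) ⟩
      1 * (n * n)                            ≡⟨ *-identityˡ (n * n) ⟩
      n * n                                  ≤⟨ weight-outer i<j (toℕ<n j) j≢ ⟩
      weight (toℕ i) (toℕ j) + F             ≡⟨ cong (_+ F) (edgeSummand-< graph i j i<j) ⟨
      S + F                                  ∎
    cases (yes i<j) (yes j≡) = begin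
      T * (n * n) + innerAt (toℕ i) (toℕ j)  ≡⟨ cong₂ _+_ (T≡0 λ _ → sym (trans (cong (_% r) j≡) ([m+n]%n≡m%n (toℕ i) r)))
                                                   (trans (cong (_* inner (toℕ i)) (ι-yes (toℕ j ≟ toℕ i + r) j≡)) (*-identityˡ _)) ⟩
      inner (toℕ i)                          ≤⟨ weight-inner (toℕ i) (≤-pred (+-cancelʳ-< r (toℕ i) (suc q) (≤-trans (≤-reflexive (cong suc (sym j≡))) (toℕ<n j)))) ⟩
      weight (toℕ i) (toℕ i + r)             ≡⟨ cong (weight (toℕ i)) j≡ ⟨
      weight (toℕ i) (toℕ j)                 ≡⟨ edgeSummand-< graph i j i<j ⟨
      S                                      ≤⟨ m≤m+n S F ⟩
      S + F                                  ∎

  ∑∑ : (ℕ → ℕ → ℕ) → ℕ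
  ∑∑ f = ∑ k (λ a → ∑ k (f a))

  ∑-lossAt : ∀ m → ∑ m lossAt ≤ μ * loss
  ∑-lossAt zero    = z≤n
  ∑-lossAt (suc m) = ≤-trans (≤-reflexive (sumFin-* m (λ i → ι (toℕ i <? μ)) loss)) (*-monoˡ-≤ loss (∑-indicator-upper μ m))

  ∑∑-forwardLoss : ∑∑ forwardLoss ≤ μ * loss
  ∑∑-forwardLoss = ≤-trans (∑-mono k λ a _ → ∑-delta-upper k (a + q) (lossAt a)) (∑-lossAt k)

  ∑∑-backwardLoss : ∑∑ backwardLoss ≤ μ * loss
  ∑∑-backwardLoss = begin
    ∑∑ backwardLoss                          ≤⟨ ∑-mono k (λ a _ → ∑-delta-upper k (a + suc s) (lossAt (a ∸ q))) ⟩
    ∑ k (λ a → lossAt (a ∸ q))               ≡⟨ cong (λ m → ∑ m (λ a → lossAt (a ∸ q))) (+-suc q r) ⟨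
    ∑ (q + suc r) (λ a → lossAt (a ∸ q))     ≡⟨ ∑-split q (suc r) (λ a → lossAt (a ∸ q)) ⟩
    ∑ q (λ a → lossAt (a ∸ q)) + ∑ (suc r) (λ a → lossAt (q + a ∸ q))
                                             ≡⟨ cong₂ _+_ (trans (∑-cong q λ a a<q → cong lossAt (m≤n⇒m∸n≡0 (<⇒≤ a<q))) (trans (sumFin-const q 0) (*-zeroʳ q)))
                                                          (∑-cong (suc r) λ a _ → cong lossAt (m+n∸m≡n q a)) ⟩
    ∑ (suc r) lossAt                         ≤⟨ ∑-lossAt (suc r) ⟩
    μ * loss                                 ∎

  ∑∑-innerAt : z + (q * (L * n) + μ * (loss + loss + gain)) ≤ ∑∑ innerAt
  ∑∑-innerAt = begin
    z + (q * (L * n) + μ * (loss + loss + gain))  ≤⟨ +-monoʳ-≤ z (+-mono-≤ (≤-reflexive (sym (sumFin-const q (L * n)))) indicators) ⟩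
    z + (∑ q (λ _ → L * n) + ∑ q (λ i → ι (i <? s) * (loss + loss + gain))) ≡⟨ cong (z +_) (sumFin-+ q _ _) ⟨
    ∑ (suc q) inner                               ≤⟨ ∑-mono (suc q) (λ a a≤q → ≤-trans (≤-reflexive (sym (diagonal a)))
                                                       (term≤∑ k (innerAt a) (+-monoˡ-< r a≤q))) ⟩
    ∑ (suc q) (λ a → ∑ k (innerAt a))             ≤⟨ m≤m+n _ _ ⟩
    ∑ (suc q) (λ a → ∑ k (innerAt a)) + ∑ r (λ a → ∑ k (innerAt (suc q + a))) ≡⟨ ∑-split (suc q) r (λ a → ∑ k (innerAt a)) ⟨
    ∑∑ innerAt                                    ∎
    where
    diagonal : ∀ a → innerAt a (a + r) ≡ inner a
    diagonal a = trans (cong (_* inner a) (ι-yes (a + r ≟ a + r) refl)) (*-identityˡ (inner a))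
    indicators : μ * (loss + loss + gain) ≤ ∑ q (λ i → ι (i <? s) * (loss + loss + gain))
    indicators = begin
      μ * (loss + loss + gain)                              ≤⟨ *-monoˡ-≤ (loss + loss + gain) (∑-indicator-lower (m⊓n≤m q s)) ⟩
      ∑ q (λ i → ι (i <? μ)) * (loss + loss + gain)         ≤⟨ *-monoˡ-≤ (loss + loss + gain) (∑-mono q λ i _ →
                                                                 ι-mono (i <? μ) (i <? s) λ i<μ → <-≤-trans i<μ (m⊓n≤n q s)) ⟩
      ∑ q (λ i → ι (i <? s)) * (loss + loss + gain)         ≡⟨ sumFin-* q (λ i → ι (toℕ i <? s)) _ ⟨
      ∑ q (λ i → ι (i <? s) * (loss + loss + gain))         ∎

  -- The losses, at most 2 μ · `loss` in all, are added to both sides and cancelled at the end: the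
  -- surplus inside the paired groups contains exactly this amount.
  many-edges : turanNumber r k * (n * n) + z + q * (L * n) + μ * gain ≤ edges graph
  many-edges = +-cancelʳ-≤ (μ * loss + μ * loss) _ _ (begin
    turanNumber r k * (n * n) + z + q * (L * n) + μ * gain + (μ * loss + μ * loss)
      ≡⟨ solve 6 (λ t z x m l g → t :+ z :+ x :+ m :* g :+ (m :* l :+ m :* l) := t :+ (z :+ (x :+ m :* (l :+ l :+ g)))) refl
           (turanNumber r k * (n * n)) z (q * (L * n)) μ loss gain ⟩
    turanNumber r k * (n * n) + (z + (q * (L * n) + μ * (loss + loss + gain)))
      ≤⟨ +-monoʳ-≤ (turanNumber r k * (n * n)) ∑∑-innerAt ⟩
    turanNumber r k * (n * n) + ∑∑ innerAt
      ≡⟨ cong (_+ ∑∑ innerAt) (trans (cong (_* (n * n)) (expand (turanSummand r k))) (sym (sumFin²-* T (n * n)))) ⟩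
    sumFin² (λ i j → T i j * (n * n)) + ∑∑ innerAt
      ≡⟨ sumFin²-+ (λ i j → T i j * (n * n)) (λ i j → innerAt (toℕ i) (toℕ j)) ⟨
    sumFin² (λ i j → T i j * (n * n) + innerAt (toℕ i) (toℕ j))
      ≤⟨ sumFin-mono (λ i → sumFin-mono (pointwise i)) ⟩
    sumFin² (λ i j → S i j + (forwardLoss (toℕ i) (toℕ j) + backwardLoss (toℕ i) (toℕ j)))
      ≡⟨ trans (sumFin²-+ S (λ i j → forwardLoss (toℕ i) (toℕ j) + backwardLoss (toℕ i) (toℕ j)))
           (cong₂ _+_ (sym (expand (edgeSummand graph))) (sumFin²-+ {k} (λ i j → forwardLoss (toℕ i) (toℕ j)) (λ i j → backwardLoss (toℕ i) (toℕ j)))) ⟩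
    edges graph + (∑∑ forwardLoss + ∑∑ backwardLoss)
      ≤⟨ +-monoʳ-≤ (edges graph) (+-mono-≤ ∑∑-forwardLoss ∑∑-backwardLoss) ⟩
    edges graph + (μ * loss + μ * loss) ∎)
    where
    open +-*-Solver
    T S : Fin k → Fin k → ℕ
    T = summand (turanSummand r k)
    S = summand (edgeSummand graph)

-- Choice of the parameters and conclusion

extend : ∀ {n} → BipartiteGraph n n → ℕ → ℕ → Bool
extend {n} B x y with x <? n | y <? n
... | yes x<n | yes y<n = B (fromℕ< x<n) (fromℕ< y<n)
... | _       | _       = false

extend-toℕ : ∀ {n} (B : BipartiteGraph n n) i j → extend B (toℕ i) (toℕ j) ≡ B i j
extend-toℕ {n} B i j with toℕ i <? n | toℕ j <? n
... | yes i<n | yes j<n = cong₂ B (fromℕ<-toℕ i i<n) (fromℕ<-toℕ j j<n)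
... | no  i≮n | _       = contradiction (toℕ<n i) i≮n
... | yes _   | no  j≮n = contradiction (toℕ<n j) j≮n

extend-free : ∀ {n t} (B : BipartiteGraph n n) → ¬ ContainsKtt B t → ∀ (f g : Fin t → ℕ) →
  (∀ p → f p < n) → (∀ p → g p < n) → (∀ {p p′} → f p ≡ f p′ → p ≡ p′) → (∀ {p p′} → g p ≡ g p′ → p ≡ p′) →
  ¬ (∀ p p′ → extend B (f p) (g p′) ≡ true)
extend-free B free f g f<n g<n f-inj g-inj all = free
  ( (λ p → fromℕ< (f<n p)) , (λ p → fromℕ< (g<n p))
  , (λ {p} {p′} eq → f-inj (F.fromℕ<-injective _ _ (f<n p) (f<n p′) eq))
  , (λ {p} {p′} eq → g-inj (F.fromℕ<-injective _ _ (g<n p) (g<n p′) eq))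
  , λ p p′ → trans (sym (extend-toℕ B (fromℕ< (f<n p)) (fromℕ< (g<n p′))))
      (trans (cong₂ (extend B) (toℕ-fromℕ< (f<n p)) (toℕ-fromℕ< (g<n p′))) (all p p′)) )

-- With L = ρ + 2 b one has L² = 4 b (L - b) + ρ², and ρ² < 4 vanishes in the quotient.
square/4-bound : ∀ ρ b → ρ < 2 → ((ρ + b * 2) * (ρ + b * 2)) / 4 ≤ b * (ρ + b * 2 ∸ b)
square/4-bound ρ b ρ<2 = ≤-pred (m<n*o⇒m/o<n (subst (λ m → (ρ + b * 2) * (ρ + b * 2) < suc (b * m) * 4) (sym half) (below ρ ρ<2)))
  where
  half : ρ + b * 2 ∸ b ≡ ρ + b
  half = trans (cong (_∸ b) (solve 2 (λ ρ b → ρ :+ b :* con 2 := ρ :+ b :+ b) refl ρ b)) (m+n∸n≡m (ρ + b) b)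
    where open +-*-Solver
  below : ∀ ρ → ρ < 2 → (ρ + b * 2) * (ρ + b * 2) < suc (b * (ρ + b)) * 4
  below 0 _ = ≤-trans (s≤s (≤-reflexive (solve 1 (λ b → (b :* con 2) :* (b :* con 2) := b :* b :* con 4) refl b))) (m≤n+m _ 3)
    where open +-*-Solver
  below 1 _ = ≤-trans (s≤s (≤-reflexive (solve 1 (λ b → (con 1 :+ b :* con 2) :* (con 1 :+ b :* con 2) := con 1 :+ b :* (con 1 :+ b) :* con 4) refl b))) (m≤n+m _ 2)
    where open +-*-Solver
  below (suc (suc _)) (s≤s (s≤s ()))

construction-bound : ∀ L q s n z → .{{_ : NonZero L}} → 8 * (suc L * suc L) ≤ n → IsZarankiewicz (suc L) n n z →
  let r = suc (q + s); k = suc q + r in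
  ExAtLeast k n (suc r) (suc L) (turanNumber r k * (n * n) + z + L * q * n + (q ⊓ s) * ((L * L) / 4))
construction-bound L q s n z 8t²≤n ((B , B-free , B-edges) , _) = graph , no-copy , enough-edges
  where
  open ≤-Reasoning
  b t : ℕ
  b = L / 2
  t = suc L

  2b≤L : b + b ≤ L
  2b≤L = ≤-trans (≤-reflexive (solve 1 (λ b → b :+ b := b :* con 2) refl b)) (m/n*n≤m L 2)
    where open +-*-Solver
  b≤L : b ≤ L
  b≤L = ≤-trans (m≤m+n b b) 2b≤L
  -- The summand `t` makes room for the b ≤ L special vertices of a class, leaving a modulus of at
  -- least 2L.
  2L+t≤n : L + L + t ≤ n
  2L+t≤n = begin
    L + L + t        ≤⟨ +-monoˡ-≤ t (+-mono-≤ (n≤1+n L) (n≤1+n L)) ⟩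
    t + t + t        ≡⟨ solve 1 (λ t → t :+ t :+ t := con 3 :* t) refl t ⟩
    3 * t            ≤⟨ *-mono-≤ {3} {8} (m≤m+n 3 5) (m≤m*n t t) ⟩
    8 * (t * t)      ≤⟨ 8t²≤n ⟩
    n                ∎
    where open +-*-Solver
  b<n : b < n
  b<n = ≤-trans (s≤s b≤L) (≤-trans (m≤n+m t (L + L)) 2L+t≤n)
  2L≤n∸b : L + L ≤ n ∸ b
  2L≤n∸b = m+n≤o⇒m≤o∸n (L + L) (≤-trans (+-monoʳ-≤ (L + L) (≤-trans b≤L (n≤1+n L))) 2L+t≤n)
  -- The intervals of all 2b owners, each of length L, must fit into one partner class.
  2bL≤n : (b + b) * L ≤ n
  2bL≤n = ≤-trans (*-mono-≤ (≤-trans 2b≤L (n≤1+n L)) (n≤1+n L)) (≤-trans (m≤n*m (t * t) 8) 8t²≤n)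

  open Construction L q s n b b<n (extend B)

  z≤extend : z ≤ ∑ n (λ x → ∑ n (λ y → ⟦ extend B x y ⟧))
  z≤extend = ≤-reflexive (trans (sym B-edges) (sumFin-cong λ x → sumFin-cong λ y → cong ⟦_⟧ (sym (extend-toℕ B x y))))

  enough-edges : turanNumber r k * (n * n) + z + L * q * n + (q ⊓ s) * ((L * L) / 4) ≤ edges graph
  enough-edges = ≤-trans (+-mono-≤
      (≤-reflexive (cong (turanNumber r k * (n * n) + z +_) (solve 3 (λ L q n → L :* q :* n := q :* (L :* n)) refl L q n)))
      (*-monoʳ-≤ (q ⊓ s) quarter))
    (EdgeCount.many-edges L q s n b z b<n (extend B) b≤L (≤-trans (m≤m+n L L) 2L≤n∸b) 2bL≤n z≤extend)
    where
    open +-*-Solver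
    quarter : (L * L) / 4 ≤ b * (L ∸ b)
    quarter = subst (λ m → (m * m) / 4 ≤ b * (m ∸ b)) (sym (m≡m%n+[m/n]*n L 2)) (square/4-bound (L % 2) b (m%n<n L 2))

  no-copy : ¬ ContainsCompleteMultipartite graph (suc r) t
  no-copy (φ , φ-injective , φ-adjacent) = <-irrefl refl (too-small part index combine part-combine index-combine
      part-index-injective v v-injective (λ e → m%n<n (toℕ (proj₁ (image e))) r)
      (λ e → class-side-true (toℕ<n (proj₁ (image e)))) (λ e → toℕ<n (proj₂ (image e))) (λ {e} {e′} → adjacent e e′))
    where
    open Freeness L q s n b b<n (extend B) 2b≤L 2L≤n∸b (extend-free B B-free) using (module Copy)
    open Copy using (too-small)
    part : Fin (suc r * t) → Fin (suc r)
    part e = proj₁ (remQuot {suc r} t e)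
    index : Fin (suc r * t) → Fin t
    index e = proj₂ (remQuot {suc r} t e)
    image : Fin (suc r * t) → Fin k × Fin n
    image e = φ (part e , index e)
    v : Fin (suc r * t) → Vertex
    v e = uncurry toVertex (image e)
    part-combine : ∀ a p → part (combine a p) ≡ a
    part-combine a p = cong proj₁ (F.remQuot-combine a p)
    index-combine : ∀ a p → index (combine {suc r} a p) ≡ p
    index-combine a p = cong proj₂ (F.remQuot-combine {suc r} a p)
    part-index-injective : ∀ {e e′} → part e ≡ part e′ → index e ≡ index e′ → e ≡ e′
    part-index-injective {e} {e′} eq eq′ = trans (sym (F.combine-remQuot {suc r} t e))
      (trans (cong₂ combine eq eq′) (F.combine-remQuot {suc r} t e′))
    v-injective : ∀ {e e′} → v e ≡ v e′ → e ≡ e′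
    v-injective {e} {e′} eq = part-index-injective (cong proj₁ same) (cong proj₂ same)
      where
      same : (part e , index e) ≡ (part e′ , index e′)
      same = φ-injective (toVertex-injective eq)
    adjacent : ∀ e e′ → part e ≢ part e′ → Adjacent (v e) (v e′)
    adjacent e e′ neq = does-true (adjacent? (v e) (v e′)) (φ-adjacent (part e) (index e) (part e′) (index e′) neq)

theorem1p2 : (t r k n z : ℕ) → .{{_ : NonZero r}} →
    2 ≤ t → r < k → k ≤ 2 * r → 8 * (t * t) ≤ n →
    IsZarankiewicz t n n z →
    ExAtLeast k n (1 + r) t
    (turanNumber r k * (n * n) + z + (t ∸ 1) * (k ∸ r ∸ 1) * n
    + ((k ∸ r ∸ 1) ⊓ (2 * r ∸ k)) * (((t ∸ 1) * (t ∸ 1)) / 4))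
theorem1p2 (suc (suc L)) r k n z (s≤s (s≤s _)) r<k k≤2r 8t²≤n zarankiewicz =
  transport r k q s r≡ k≡ (construction-bound (suc L) q s n z 8t²≤n zarankiewicz)
  where
  q s : ℕ
  q = k ∸ r ∸ 1
  s = 2 * r ∸ k
  k≡ : k ≡ suc q + r
  k≡ = sym (trans (cong (_+ r) (m+[n∸m]≡n (m<n⇒0<n∸m r<k))) (m∸n+n≡m (<⇒≤ r<k)))
  r≡ : r ≡ suc (q + s)
  r≡ = +-cancelʳ-≡ r r (suc (q + s)) (begin
    r + r                ≡⟨ cong (r +_) (+-identityʳ r) ⟨
    2 * r                ≡⟨ m+[n∸m]≡n k≤2r ⟨
    k + s                ≡⟨ cong (_+ s) k≡ ⟩
    suc q + r + s        ≡⟨ solve 3 (λ q r s → con 1 :+ q :+ r :+ s := con 1 :+ (q :+ s) :+ r) refl q r s ⟩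
    suc (q + s) + r      ∎)
    where
    open ≡-Reasoning
    open +-*-Solver
  -- Above, `q` and `s` are computed from `r` and `k`, so the two equations cannot be matched with
  -- `refl`; with all four as variables they can.
  transport : ∀ r k q s → .{{_ : NonZero r}} → r ≡ suc (q + s) → k ≡ suc q + r → ∀ {L n z c} →
    ExAtLeast (suc q + suc (q + s)) n (suc (suc (q + s))) (suc L)
      (turanNumber (suc (q + s)) (suc q + suc (q + s)) * (n * n) + z + L * q * n + (q ⊓ s) * c) →
    ExAtLeast k n (suc r) (suc L) (turanNumber r k * (n * n) + z + L * q * n + (q ⊓ s) * c)
  transport r k q s refl refl bound = bound
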